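{- Let $n \ge 3$ and $m\ge 2$ be integers. Then $$a_1(C_n \,\square\, P_m) = \begin{cases} 2; & (n = 3 \text{ and } 2\le m \le 5), \text{ or } (n = 4 \text{ and } m=2),\\ 3; & (n = 3 \text{ and } m \ge 6), \text{ or } (n = 4 \text{ and } 3 \le m \le 5), \text{ or } (n=5 \text{ and } 2 \le m \le 4),\\ & \text{or } (6 \le n \le 9 \text{ and } m\in\{2,3\}), \text{ or } (n \ge 10 \text{ and } m=2),\\ 4; & \text{otherwise}, \end{cases}$$ and $$a_1'(C_n \,\square\, P_m) = \begin{cases} 2; & n=3,\ m=2,\\ 3; & (n=3 \text{ and } m \ge 3), \text{ or } (n \ge 4 \text{ and } m=2),\\ 4; & n \ge 4,\ m \ge 3. \end{cases}$$
   Context: $C_n$ and $P_n$ are the cycle and the path on $n$ vertices, respectively. The Cartesian product $G\,\square\, H$ of graphs $G$ and $H$ has vertex set $V(G)\times V(H)$, with $(g,h)$ and $(g',h')$ adjacent if either $gg'\in E(G)$ and $h=h'$, or $g=g'$ and $hh'\in E(H)$. A clique of a graph $G$ is an inclusion-wise maximal complete subgraph. The $(a,b)$-monochromatic clique transversal game ($(a,b)$-MCT game) on $G$ is played by Alice and Bob, who alternately take turns: in each of her turns Alice chooses $a$ unplayed vertices and colors them red, and in each of his turns Bob chooses $b$ unplayed vertices and colors them blue (if fewer unplayed vertices remain, the player colors all of them). Alice wins if the red vertices contain at least one vertex of each clique of $G$; Bob wins if all vertices of some clique of $G$ are blue. The game is Alice-start or Bob-start depending on who moves first. The threshold $a_1(G)$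 (resp. $a_1'(G)$) is the smallest positive integer $a$ such that Alice has a winning strategy in the Alice-start (resp. Bob-start) $(a,1)$-MCT game on $G$. -}

module Defs where

open import Data.Fin as Fin using (Fin; toℕ)
open import Data.List
  using (List; []; _++_; length; take; filter; deduplicate; allFin; cartesianProduct)
open import Data.List.Membership.DecPropositional as DecMembership using ()
open import Data.List.Membership.Propositional using (_∈_; _∉_)
open import Data.List.Membership.Propositional.Properties
  using (∈-allFin; ∈-cartesianProduct⁺; ∈-filter⁺; ∈-deduplicate⁺; ∈-++⁺ʳ; ∈-++⁻)
open import Data.List.Properties using (length-take; take-all)
open import Data.List.Relation.Binary.Disjoint.Propositional using (Disjoint)
open import Data.List.Relation.Binary.Subset.Propositional using (_⊆_)
open import Data.List.Relation.Unary.All as All using (All)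
open import Data.List.Relation.Unary.All.Properties as Allₚ using ()
open import Data.List.Relation.Unary.Unique.Propositional using (Unique)
open import Data.List.Relation.Unary.Unique.Propositional.Properties using (filter⁺; take⁺)
open import Data.List.Relation.Unary.Unique.DecPropositional.Properties using (deduplicate-!)
open import Data.Nat using (ℕ; suc; _≤_; _<_; s≤s; _≤?_)
open import Data.Nat.Properties using (1+n≢n; m≤n⇒m⊓n≡m; ≰⇒>; ≰⇒≥)
open import Data.Product using (∃-syntax; _×_; _,_; proj₁; proj₂)
open import Data.Product.Properties using (≡-dec)
open import Data.Sum using (_⊎_; inj₁; inj₂; swap)
open import Relation.Binary.Definitions using (Symmetric; DecidableEquality)
open import Relation.Binary.PropositionalEquality using (_≡_; _≢_; cong; sym; trans)
open import Relation.Nullary using (¬_; yes; no; ¬?; _×-dec_)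
open import Relation.Unary using (Decidable)

-- Finite simple graphs.
record Graph : Set₁ where
  field
    Vertex     : Set
    Adj        : Vertex → Vertex → Set
    adj-sym    : Symmetric Adj
    adj-irrefl : ∀ {v} → ¬ Adj v v
    _≟_        : DecidableEquality Vertex
    vertices   : List Vertex
    ∈-vertices : ∀ v → v ∈ vertices

path : ℕ → Graph
path n = record
  { Vertex     = Fin n
  ; Adj        = λ i j → suc (toℕ i) ≡ toℕ j ⊎ suc (toℕ j) ≡ toℕ i
  ; adj-sym    = swap
  ; adj-irrefl = λ { (inj₁ e) → 1+n≢n e ; (inj₂ e) → 1+n≢n e }
  ; _≟_        = Fin._≟_
  ; vertices   = allFin n
  ; ∈-vertices = ∈-allFin
  }

-- j is the cyclic successor of i: either i + 1 = j, or i = n - 1 and j = 0.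
CyclicSuc : ∀ {n} → Fin n → Fin n → Set
CyclicSuc {n} i j =
  suc (toℕ i) ≡ toℕ j ⊎ (suc (toℕ i) ≡ n × toℕ j ≡ 0)

cycle : (n : ℕ) → 3 ≤ n → Graph
cycle n 3≤n = record
  { Vertex     = Fin n
  ; Adj        = λ i j → CyclicSuc i j ⊎ CyclicSuc j i
  ; adj-sym    = swap
  ; adj-irrefl = λ { (inj₁ s) → irrefl 3≤n s ; (inj₂ s) → irrefl 3≤n s }
  ; _≟_        = Fin._≟_
  ; vertices   = allFin n
  ; ∈-vertices = ∈-allFin
  }
  where
  irrefl : ∀ {n} → 3 ≤ n → {i : Fin n} → ¬ CyclicSuc i i
  irrefl _             (inj₁ e) = 1+n≢n e
  irrefl (s≤s (s≤s _)) (inj₂ (i+1≡n , i≡0)) with trans (sym i+1≡n) (cong suc i≡0)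
  ... | ()

infixl 7 _□_
_□_ : Graph → Graph → Graph
G □ H = record
  { Vertex     = G.Vertex × H.Vertex
  ; Adj        = λ { (g , h) (g′ , h′) →
                     (G.Adj g g′ × h ≡ h′) ⊎ (g ≡ g′ × H.Adj h h′) }
  ; adj-sym    = λ { (inj₁ (e , eq)) → inj₁ (G.adj-sym e , sym eq)
                   ; (inj₂ (eq , e)) → inj₂ (sym eq , H.adj-sym e) }
  ; adj-irrefl = λ { (inj₁ (e , _)) → G.adj-irrefl e
                   ; (inj₂ (_ , e)) → H.adj-irrefl e }
  ; _≟_        = ≡-dec G._≟_ H._≟_
  ; vertices   = cartesianProduct G.vertices H.vertices
  ; ∈-vertices = λ { (g , h) → ∈-cartesianProduct⁺ (G.∈-vertices g) (H.∈-vertices h) }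
  }
  where
  module G = Graph G
  module H = Graph H

data Player : Set where
  alice bob : Player

module _ (G : Graph) where
  open Graph G

  -- Vertex sets of subgraphs are given by lists; order and repetitions of the
  -- entries are irrelevant here.
  Complete : List Vertex → Set
  Complete K = ∀ {u v} → u ∈ K → v ∈ K → u ≢ v → Adj u v

  IsClique : List Vertex → Set
  IsClique K = Complete K × (∀ L → Complete L → K ⊆ L → L ⊆ K)

  record Position : Set where
    constructor ⟨_,_⟩
    field
      red blue : List Vertex

  open Position

  start : Position
  start = ⟨ [] , [] ⟩

  Unplayed : Position → Vertex → Set
  Unplayed p v = v ∉ red p × v ∉ blue p

  -- S is a set of k unplayed vertices, or of all the unplayed vertices if there
  -- are fewer than k of them.
  LegalMove : ℕ → Position → List Vertex → Set
  LegalMove k p S =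
    Unique S × All (Unplayed p) S ×
    (length S ≡ k ⊎ (length S < k × (∀ v → Unplayed p v → v ∈ S)))

  colourRed colourBlue : Position → List Vertex → Position
  colourRed  p S = ⟨ S ++ red p , blue p ⟩
  colourBlue p S = ⟨ red p , S ++ blue p ⟩

  AliceWon : Position → Set
  AliceWon p = ∀ K → IsClique K → ∃[ v ] (v ∈ K × v ∈ red p)

  BobWon : Position → Set
  BobWon p = ∃[ K ] (IsClique K × K ⊆ blue p)

  -- Winning strategies of Alice in the (a,b)-game from a given position with a
  -- given player to move, as well-founded strategy trees: one move is selected
  -- at each of Alice's turns, all legal moves are answered at each of Bob's
  -- turns, and every branch ends with Alice having won.  Play need not be
  -- stopped explicitly when Bob has won: see aliceWins⇒¬bobWon below.
  data AliceWins (a b : ℕ) : Player → Position → Set where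
    won        : ∀ {t p} → AliceWon p → AliceWins a b t p
    alice-move : ∀ {p} S → LegalMove a p S →
                 AliceWins a b bob (colourRed p S) →
                 AliceWins a b alice p
    bob-move   : ∀ {p} →
                 (∀ S → LegalMove b p S → AliceWins a b alice (colourBlue p S)) →
                 AliceWins a b bob p

  legalMove-exists : ∀ k p → ∃[ S ] LegalMove k p S
  legalMove-exists k p = take k free , take⁺ k free! , Allₚ.take⁺ k free-unplayed , size
    where
    open DecMembership _≟_ using (_∈?_)

    unplayed? : Decidable (Unplayed p)
    unplayed? v = ¬? (v ∈? red p) ×-dec ¬? (v ∈? blue p)

    free : List Vertex
    free = filter unplayed? (deduplicate _≟_ vertices)

    free! : Unique free
    free! = filter⁺ unplayed? (deduplicate-! _≟_ vertices)

    free-unplayed : All (Unplayed p) free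
    free-unplayed = Allₚ.all-filter unplayed? (deduplicate _≟_ vertices)

    ∈-free : ∀ v → Unplayed p v → v ∈ free
    ∈-free v = ∈-filter⁺ unplayed? (∈-deduplicate⁺ _≟_ (∈-vertices v))

    size : length (take k free) ≡ k ⊎
           (length (take k free) < k × (∀ v → Unplayed p v → v ∈ take k free))
    size with k ≤? length free
    ... | yes k≤ = inj₁ (trans (length-take k free) (m≤n⇒m⊓n≡m k≤))
    ... | no  k≰ rewrite take-all k free (≰⇒≥ k≰) = inj₂ (≰⇒> k≰ , ∈-free)

  aliceWins⇒¬bobWon : ∀ {a b t p} → Disjoint (red p) (blue p) →
                      AliceWins a b t p → ¬ BobWon p
  aliceWins⇒¬bobWon r#b (won w) (K , K-clique , K⊆blue) =
    let v , v∈K , v∈red = w K K-clique in r#b (v∈red , K⊆blue v∈K)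
  aliceWins⇒¬bobWon {p = p} r#b (alice-move S (_ , S-free , _) w) =
    aliceWins⇒¬bobWon r#b′ w
    where
    r#b′ : Disjoint (S ++ red p) (blue p)
    r#b′ (v∈ , v∈blue) with ∈-++⁻ S v∈
    ... | inj₁ v∈S   = proj₂ (All.lookup S-free v∈S) v∈blue
    ... | inj₂ v∈red = r#b (v∈red , v∈blue)
  aliceWins⇒¬bobWon {b = b} {p = p} r#b (bob-move f) (K , K-clique , K⊆blue)
    with legalMove-exists b p
  ... | S , legal@(_ , S-free , _) =
    aliceWins⇒¬bobWon r#b′ (f S legal) (K , K-clique , λ v∈K → ∈-++⁺ʳ S (K⊆blue v∈K))
    where
    r#b′ : Disjoint (red p) (S ++ blue p)
    r#b′ (v∈red , v∈) with ∈-++⁻ S v∈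
    ... | inj₁ v∈S    = proj₁ (All.lookup S-free v∈S) v∈red
    ... | inj₂ v∈blue = r#b (v∈red , v∈blue)

IsSmallestPositive : (ℕ → Set) → ℕ → Set
IsSmallestPositive P k = 1 ≤ k × P k × (∀ j → 1 ≤ j → P j → k ≤ j)

-- `G HasA₁ k` says a₁(G) = k and `G HasA₁′ k` says a₁′(G) = k.
infix 4 _HasA₁_ _HasA₁′_
_HasA₁_ _HasA₁′_ : Graph → ℕ → Set
G HasA₁  k = IsSmallestPositive (λ a → AliceWins G a 1 alice (start G)) k
G HasA₁′ k = IsSmallestPositive (λ a → AliceWins G a 1 bob   (start G)) k

{-# OPTIONS --safe #-}
{- A Bob move v threatens every unplayed w that completes a blue clique, so Alice
must take all these w in her next move.

Alice fixes a symmetric relation H, an edge of which lies in every clique, and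
always answers v by its unplayed H-neighbours; then no H-edge ever becomes blue.
This costs at most a vertices per turn as soon as every vertex has at most a
H-neighbours outside her opening set R₀, or lies in R₀.  For n ≥ 4, H is
adjacency and R₀ dominates the vertices of degree > a; for n = 3, H consists of the
path edges and of one edge of each triangle.

Bob, for n ≥ 4, wins at once at a vertex of degree > a whose closed neighbourhood
contains no red.  If there is none in layer j, then the at most a opening reds
satisfy n ≤ 3 kⱼ + kⱼ₋₁ + kⱼ₊₁, where kⱼ is the number of reds in layer j;
combining these inequalities for a few layers gives a contradiction.  For n = 3 he
plays two vertices of one triangle in succession. -}

module Submission where

open import Defs
import Data.Nat.Properties
open import Algebra.Properties.CommutativeSemigroup Data.Nat.Properties.+-commutativeSemigroup using (interchange)
open import Data.Empty using (⊥-elim)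
open import Data.Fin as Fin using (#_; Fin; zero; suc; toℕ; fromℕ<)
open import Data.Fin.Properties as Finₚ using (toℕ-injective; toℕ<n; toℕ-fromℕ<)
open import Data.List using (List; []; _∷_; _++_; length; map; concatMap; filter; deduplicate; allFin)
open import Data.List.Membership.DecPropositional as DecMembership using ()
open import Data.List.Membership.Propositional using (_∈_; _∉_; find; lose)
open import Data.List.Membership.Propositional.Properties using (∈-∃++; ∈-++⁺ˡ; ∈-++⁺ʳ; ∈-++⁻; ∈-filter⁺; ∈-filter⁻; ∈-deduplicate⁺; ∈-deduplicate⁻; ∈-allFin; ∈-map⁺; ∈-map⁻; ∈-concatMap⁺)
open import Data.List.Properties using (++-identityʳ; length-++; length-filter; length-map; length-tabulate)
open import Data.List.Relation.Binary.Disjoint.Propositional using (Disjoint)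
open import Data.List.Relation.Binary.Subset.Propositional using (_⊆_)
open import Data.List.Relation.Unary.All as All using (All; []; _∷_)
open import Data.List.Relation.Unary.All.Properties as Allₚ using ()
open import Data.List.Relation.Unary.AllPairs using ([]; _∷_)
open import Data.List.Relation.Unary.Any as Any using (Any; here; there)
open import Data.List.Relation.Unary.Any.Properties using (¬Any[])
open import Data.List.Relation.Unary.Unique.DecPropositional.Properties using (deduplicate-!)
open import Data.List.Relation.Unary.Unique.Propositional using (Unique)
open import Data.List.Relation.Unary.Unique.Propositional.Properties as Uniqueₚ using (allFin⁺)
open import Data.Nat using (ℕ; zero; suc; _+_; _*_; _∸_; _≤_; _<_; z≤n; s≤s)
open import Data.Nat.ListAction using (sum)
open import Data.Nat.Properties as ℕₚ hiding (_≟_)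
open import Data.Product using (∃; ∃₂; ∃-syntax; _×_; _,_; proj₁; proj₂)
open import Data.Sum using (_⊎_; inj₁; inj₂; [_,_]; swap)
open import Function using (_∘_; id)
open import Relation.Binary.Definitions using (Symmetric)
open import Relation.Binary.PropositionalEquality using (_≡_; _≢_; refl; sym; trans; cong; cong₂; subst)
open import Relation.Nullary.Decidable using (True; toWitness)
open import Relation.Nullary using (¬_; Dec; yes; no; contradiction; ¬?; _×-dec_; _⊎-dec_; from-yes)
open import Relation.Unary using (Decidable)

-- Counting in duplicate-free and filtered lists.

pigeonhole : ∀ {A : Set} {xs ys : List A} → Unique xs → xs ⊆ ys → length xs ≤ length ys
pigeonhole {xs = []} _ _ = z≤n
pigeonhole {xs = x ∷ xs} (x# ∷ xs!) sub with ∈-∃++ (sub (here refl))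
... | as , bs , refl = begin
  suc (length xs)             ≤⟨ s≤s (pigeonhole xs! sub′) ⟩
  suc (length (as ++ bs))     ≡⟨ cong suc (length-++ as) ⟩
  suc (length as + length bs) ≡⟨ +-suc (length as) (length bs) ⟨
  length as + suc (length bs) ≡⟨ length-++ as ⟨
  length (as ++ x ∷ bs)       ∎
  where
  open ≤-Reasoning
  sub′ : xs ⊆ as ++ bs
  sub′ y∈ with ∈-++⁻ as (sub (there y∈))
  ... | inj₁ y∈as         = ∈-++⁺ˡ y∈as
  ... | inj₂ (here y≡x)   = contradiction (sym y≡x) (All.lookup x# y∈)
  ... | inj₂ (there y∈bs) = ∈-++⁺ʳ as y∈bs

module _ {A : Set} {P Q : A → Set} (P? : Decidable P) (Q? : Decidable Q) (P⊆Q : ∀ {x} → P x → Q x) where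

  filter-⊆-≤ : ∀ xs → length (filter P? xs) ≤ length (filter Q? xs)
  filter-⊆-≤ [] = z≤n
  filter-⊆-≤ (x ∷ xs) with P? x | Q? x
  ... | yes _ | yes _ = s≤s (filter-⊆-≤ xs)
  ... | yes p | no ¬q = contradiction (P⊆Q p) ¬q
  ... | no _  | yes _ = m≤n⇒m≤1+n (filter-⊆-≤ xs)
  ... | no _  | no _  = filter-⊆-≤ xs

  filter-shrinks : ∀ {x xs} → x ∈ xs → Q x → ¬ P x → length (filter P? xs) < length (filter Q? xs)
  filter-shrinks {x} {_ ∷ xs} (here refl) q ¬p with P? x | Q? x
  ... | yes p | _     = contradiction p ¬p
  ... | no _  | yes _ = s≤s (filter-⊆-≤ xs)
  ... | no _  | no ¬q = contradiction q ¬q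
  filter-shrinks {xs = y ∷ _} (there x∈) q ¬p with P? y | Q? y
  ... | yes _  | yes _ = s≤s (filter-shrinks x∈ q ¬p)
  ... | yes py | no ¬q = contradiction (P⊆Q py) ¬q
  ... | no _   | yes _ = m≤n⇒m≤1+n (filter-shrinks x∈ q ¬p)
  ... | no _   | no _  = filter-shrinks x∈ q ¬p

-- The game on an arbitrary graph.

module _ (G : Graph) where
  open Graph G
  open Position
  open DecMembership _≟_ using (_∈?_)

  private
    V = Vertex
    Pos = Position G

  unplayed? : (p : Pos) → Decidable (Unplayed G p)
  unplayed? p v = ¬? (v ∈? red p) ×-dec ¬? (v ∈? blue p)

  ¬unplayed⇒played : ∀ p {v} → ¬ Unplayed G p v → v ∈ red p ⊎ v ∈ blue p
  ¬unplayed⇒played p {v} ¬u with v ∈? red p | v ∈? blue p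
  ... | yes r | _     = inj₁ r
  ... | no _  | yes b = inj₂ b
  ... | no r  | no b  = contradiction (r , b) ¬u

  -- A legal move has exactly `a` vertices or exhausts the free ones, so a smaller set of required
  -- vertices must be padded. The padding is any legal move of size `a ∸ length S` in the position
  -- where `S` is already red, which keeps the two parts disjoint.
  extendMove : ∀ a p S → Unique S → All (Unplayed G p) S → length S ≤ a →
               ∃[ T ] (LegalMove G a p T × S ⊆ T)
  extendMove a p S S! S-free |S|≤a
    with legalMove-exists G (a ∸ length S) (colourRed G p S)
  ... | T , T! , T-free , size =
    T ++ S , (Uniqueₚ.++⁺ T! S! T#S , Allₚ.++⁺ T-free′ S-free , size′ size) , ∈-++⁺ʳ T
    where
    T#S : Disjoint T S
    T#S (v∈T , v∈S) = proj₁ (All.lookup T-free v∈T) (∈-++⁺ˡ v∈S)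
    T-free′ : All (Unplayed G p) T
    T-free′ = All.map (λ (r , b) → r ∘ ∈-++⁺ʳ S , b) T-free
    |T++S| : length (T ++ S) ≡ length T + length S
    |T++S| = length-++ T
    size′ : length T ≡ a ∸ length S ⊎
            (length T < a ∸ length S × (∀ v → Unplayed G (colourRed G p S) v → v ∈ T)) →
            length (T ++ S) ≡ a ⊎ (length (T ++ S) < a × (∀ v → Unplayed G p v → v ∈ T ++ S))
    size′ (inj₁ eq) = inj₁ (trans |T++S| (trans (cong (_+ length S) eq) (m∸n+n≡m |S|≤a)))
    size′ (inj₂ (lt , rest)) =
      inj₂ ( ≤-trans (≤-reflexive (cong suc |T++S|))
               (≤-trans (+-monoˡ-≤ (length S) lt) (≤-reflexive (m∸n+n≡m |S|≤a)))
           , λ v (r , b) → all v r b)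
      where
      all : ∀ v → v ∉ red p → v ∉ blue p → v ∈ T ++ S
      all v r b with v ∈? S
      ... | yes v∈S = ∈-++⁺ʳ T v∈S
      ... | no  v∉S = ∈-++⁺ˡ (rest v ([ v∉S , r ] ∘ ∈-++⁻ S , b))

  -- Alice's strategy along a symmetric relation.

  module Pairing
    (a : ℕ) (R₀ : List V) (H : V → V → Set)
    (H-sym : Symmetric H) (H-irrefl : ∀ {v} → ¬ H v v)
    (H-in-clique : ∀ K → IsClique G K → ∃₂ λ u w → u ∈ K × w ∈ K × H u w)
    (replies : ∀ v → v ∈ R₀ ⊎ ∃[ C ] (length C ≤ a × (∀ w → H v w → w ∈ R₀ ⊎ w ∈ C)))
    where

    -- Holds whenever Bob is to move. The second half is stronger than the absence of blue
    -- `H`-edges: it says that no blue vertex has an `H`-neighbour still to be taken.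
    Inv : Pos → Set
    Inv p = R₀ ⊆ red p × (∀ {v w} → v ∈ blue p → H v w → w ∈ red p)

    finished⇒won : ∀ {p} → Inv p → (∀ v → ¬ Unplayed G p v) → AliceWon G p
    finished⇒won {p} (_ , inv) full K K-clique with H-in-clique K K-clique
    ... | u , w , u∈K , w∈K , h with ¬unplayed⇒played p (full u)
    ... | inj₁ u∈red  = u , u∈K , u∈red
    ... | inj₂ u∈blue = w , w∈K , inv u∈blue h

    free : Pos → List V
    free p = filter (unplayed? p) vertices

    -- Alice takes the vertices of `C` that are still free. An `H`-neighbour of `v` that is already
    -- played must be red: were it blue, the invariant and symmetry would have made `v` red before
    -- Bob's move.
    reply : ∀ {p v} → Inv p → Unplayed G p v →
            ∃[ S ] (LegalMove G a (colourBlue G p (v ∷ [])) S ×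
                    Inv (colourRed G (colourBlue G p (v ∷ [])) S))
    reply {p} {v} (R₀⊆red , inv) (v∉red , v∉blue) with replies v
    ... | inj₁ v∈R₀ = contradiction (R₀⊆red v∈R₀) v∉red
    ... | inj₂ (C , |C|≤a , H⊆C) = S , S-legal , ∈-++⁺ʳ S ∘ R₀⊆red , inv′
      where
      q = colourBlue G p (v ∷ [])
      S₀ = filter (unplayed? q) (deduplicate _≟_ C)
      S₀! : Unique S₀
      S₀! = Uniqueₚ.filter⁺ (unplayed? q) (deduplicate-! _≟_ C)
      |S₀|≤a : length S₀ ≤ a
      |S₀|≤a = ≤-trans
        (pigeonhole S₀! (∈-deduplicate⁻ _≟_ C ∘ proj₁ ∘ ∈-filter⁻ (unplayed? q))) |C|≤a
      ext = extendMove a q S₀ S₀! (Allₚ.all-filter (unplayed? q) (deduplicate _≟_ C)) |S₀|≤a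
      S = proj₁ ext
      S-legal = proj₁ (proj₂ ext)
      inv′ : ∀ {u w} → u ∈ v ∷ blue p → H u w → w ∈ S ++ red p
      inv′ (there u∈blue) h = ∈-++⁺ʳ S (inv u∈blue h)
      inv′ {w = w} (here refl) h with H⊆C w h
      ... | inj₁ w∈R₀ = ∈-++⁺ʳ S (R₀⊆red w∈R₀)
      ... | inj₂ w∈C with unplayed? q w
      ... | yes w-free =
        ∈-++⁺ˡ (proj₂ (proj₂ ext) (∈-filter⁺ (unplayed? q) (∈-deduplicate⁺ _≟_ w∈C) w-free))
      ... | no ¬w-free with ¬unplayed⇒played q ¬w-free
      ... | inj₁ w∈red          = ∈-++⁺ʳ S w∈red
      ... | inj₂ (here refl)    = contradiction h H-irrefl
      ... | inj₂ (there w∈blue) = contradiction (inv w∈blue (H-sym h)) v∉red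

    -- Induction on a bound `k` for the number of free vertices, which drops because Bob's vertex
    -- `v` is no longer free.
    aliceWins-bob′ : ∀ k p → length (free p) < k → Inv p → AliceWins G a 1 bob p
    aliceWins-bob′ (suc k) p (s≤s |free|≤k) inv = bob-move answer
      where
      answer : ∀ S → LegalMove G 1 p S → AliceWins G a 1 alice (colourBlue G p S)
      -- An empty move of Bob is legal only on a full board, where the invariant already gives a red
      -- vertex in every clique.
      answer [] (_ , _ , inj₂ (_ , full)) =
        won (finished⇒won inv (λ v v-free → ¬Any[] (full v v-free)))
      answer (_ ∷ _ ∷ _) (_ , _ , inj₁ ())
      answer (_ ∷ _ ∷ _) (_ , _ , inj₂ (s≤s () , _))
      answer (v ∷ []) (_ , v-free ∷ [] , _) with reply inv v-free
      ... | S , S-legal , inv′ = alice-move S S-legal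
        (aliceWins-bob′ k _ (≤-trans fewer-free |free|≤k) inv′)
        where
        shrink : ∀ {w} → Unplayed G (colourRed G (colourBlue G p (v ∷ [])) S) w → Unplayed G p w
        shrink (r , b) = r ∘ ∈-++⁺ʳ S , b ∘ there
        played : ¬ Unplayed G (colourRed G (colourBlue G p (v ∷ [])) S) v
        played (_ , b) = b (here refl)
        fewer-free = filter-shrinks (unplayed? _) (unplayed? p) shrink (∈-vertices v) v-free played

    aliceWins-bob : ∀ {p} → Inv p → AliceWins G a 1 bob p
    aliceWins-bob {p} = aliceWins-bob′ _ p ≤-refl

    aliceWins-alice : length R₀ ≤ a → AliceWins G a 1 alice (start G)
    aliceWins-alice |R₀|≤a
      with extendMove a (start G) (deduplicate _≟_ R₀) (deduplicate-! _≟_ R₀)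
             (All.tabulate (λ _ → ¬Any[] , ¬Any[]))
             (≤-trans (pigeonhole (deduplicate-! _≟_ R₀) (∈-deduplicate⁻ _≟_ R₀)) |R₀|≤a)
    ... | S , S-legal , R₀⊆S = alice-move S S-legal
      (aliceWins-bob (∈-++⁺ˡ ∘ R₀⊆S ∘ ∈-deduplicate⁺ _≟_ , λ ()))

  module Replies
    (H : V → V → Set) (H-sym : Symmetric H) (H-irrefl : ∀ {v} → ¬ H v v)
    (H-in-clique : ∀ K → IsClique G K → ∃₂ λ u w → u ∈ K × w ∈ K × H u w)
    (near : V → List V) (near-complete : ∀ {v w} → H v w → w ∈ near v)
    where

    -- A decidable form of the hypothesis `replies` of `Pairing`, in which `C` is the part of the
    -- neighbour list outside the opening set.
    Few : ℕ → List V → V → Set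
    Few a R₀ v = v ∈ R₀ ⊎ length (filter (λ w → ¬? (w ∈? R₀)) (near v)) ≤ a

    few? : ∀ a R₀ → Decidable (Few a R₀)
    few? a R₀ v = v ∈? R₀ ⊎-dec length (filter (λ w → ¬? (w ∈? R₀)) (near v)) ≤? a

    private
      replies : ∀ {a R₀} → (∀ v → Few a R₀ v) →
                ∀ v → v ∈ R₀ ⊎ ∃[ C ] (length C ≤ a × (∀ w → H v w → w ∈ R₀ ⊎ w ∈ C))
      replies {R₀ = R₀} few v with few v
      ... | inj₁ v∈R₀ = inj₁ v∈R₀
      ... | inj₂ ≤a = inj₂ (_ , ≤a , sub)
        where
        sub : ∀ w → H v w → w ∈ R₀ ⊎ w ∈ filter (λ w → ¬? (w ∈? R₀)) (near v)
        sub w h with w ∈? R₀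
        ... | yes w∈ = inj₁ w∈
        ... | no  w∉ = inj₂ (∈-filter⁺ (λ w → ¬? (w ∈? R₀)) (near-complete h) w∉)

      short : ∀ {a} → (∀ v → length (near v) ≤ a) → ∀ v → Few a [] v
      short ≤a v = inj₂ (≤-trans (length-filter (λ w → ¬? (w ∈? [])) (near v)) (≤a v))

    -- On a concrete graph the two implicit `True` arguments are found by evaluation, so that naming
    -- an opening set is the whole proof.
    check⇒alice : ∀ a R₀ → {True (length R₀ ≤? a)} → {True (All.all? (few? a R₀) vertices)} →
                  AliceWins G a 1 alice (start G)
    check⇒alice a R₀ {|R₀|≤a} {few} = Pairing.aliceWins-alice a R₀ H H-sym H-irrefl H-in-clique
      (replies (λ v → All.lookup (toWitness few) (∈-vertices v))) (toWitness |R₀|≤a)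

    short⇒alice : ∀ {a} → (∀ v → length (near v) ≤ a) → AliceWins G a 1 alice (start G)
    short⇒alice {a} ≤a = Pairing.aliceWins-alice a [] H H-sym H-irrefl H-in-clique
      (replies (short ≤a)) z≤n

    short⇒bob : ∀ {a} → (∀ v → length (near v) ≤ a) → AliceWins G a 1 bob (start G)
    short⇒bob {a} ≤a = Pairing.aliceWins-bob a [] H H-sym H-irrefl H-in-clique
      (replies (short ≤a)) ((λ ()) , λ ())

  -- Bob's threats.

  Apart : Pos → Set
  Apart p = Disjoint (red p) (blue p)

  Threat : Pos → V → Set
  Threat p w = Unplayed G p w × ∃[ K ] (IsClique G K × K ⊆ w ∷ blue p)

  bob-plays : ∀ {a p v} → AliceWins G a 1 bob p → Unplayed G p v →
              AliceWins G a 1 alice (colourBlue G p (v ∷ []))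
  bob-plays (won w)      _      = won w
  bob-plays (bob-move f) v-free = f _ ([] ∷ [] , v-free ∷ [] , inj₁ refl)

  apart-bob : ∀ {p v} → Apart p → Unplayed G p v → Apart (colourBlue G p (v ∷ []))
  apart-bob r#b (r , _) (x∈red , here refl)    = r x∈red
  apart-bob r#b _       (x∈red , there x∈blue) = r#b (x∈red , x∈blue)

  -- A threatened vertex omitted by Alice would be played by Bob and complete a blue clique, which a
  -- winning strategy excludes. At a leaf `won` every clique already has a red vertex, so there are
  -- no threats and the empty answer serves.
  alice-answers : ∀ {a p} → Apart p → AliceWins G a 1 alice p →
    ∃[ S ] (length S ≤ a × All (Unplayed G p) S × AliceWins G a 1 bob (colourRed G p S) ×
            (∀ {w} → Threat p w → w ∈ S))
  alice-answers {p = p} r#b (won wins) = [] , z≤n , [] , won wins , no-threat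
    where
    no-threat : ∀ {w} → Threat p w → w ∈ []
    no-threat ((w∉red , _) , K , K-clique , K⊆) with wins K K-clique
    ... | v , v∈K , v∈red with K⊆ v∈K
    ... | here refl    = contradiction v∈red w∉red
    ... | there v∈blue = contradiction (v∈red , v∈blue) r#b
  alice-answers {a} {p} r#b (alice-move S (_ , S-free , size) wins) =
    S , [ ≤-reflexive , <⇒≤ ∘ proj₁ ] size , S-free , wins , answered
    where
    r#b′ : Apart (colourRed G p S)
    r#b′ (x∈ , x∈blue) with ∈-++⁻ S x∈
    ... | inj₁ x∈S   = proj₂ (All.lookup S-free x∈S) x∈blue
    ... | inj₂ x∈red = r#b (x∈red , x∈blue)
    answered : ∀ {w} → Threat p w → w ∈ S
    answered {w} ((w∉red , w∉blue) , K , K-clique , K⊆) with w ∈? S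
    ... | yes w∈S = w∈S
    ... | no  w∉S = ⊥-elim
      (aliceWins⇒¬bobWon G (apart-bob r#b′ w-free) (bob-plays wins w-free) (K , K-clique , K⊆))
      where
      w-free : Unplayed G (colourRed G p S) w
      w-free = [ w∉S , w∉red ] ∘ ∈-++⁻ S , w∉blue

  threats≤a : ∀ {a p T} → Apart p → Unique T → All (Threat p) T → AliceWins G a 1 alice p →
              length T ≤ a
  threats≤a r#b T! T-threat wins with alice-answers r#b wins
  ... | _ , |S|≤a , _ , _ , answered =
    ≤-trans (pigeonhole T! (answered ∘ All.lookup T-threat)) |S|≤a

  -- Reduces the Alice-start game to the Bob-start game from an arbitrary opening. Only the bound
  -- `k` on the size of the opening is kept, which is all that the counting arguments use.
  alice-loses : ∀ {a k} → a ≤ k →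
                (∀ {a R} → a ≤ k → length R ≤ k → ¬ AliceWins G a 1 bob ⟨ R , [] ⟩) →
                ¬ AliceWins G a 1 alice (start G)
  alice-loses a≤k bob-wins wins with alice-answers (λ { (() , _) }) wins
  ... | S , |S|≤a , _ , wins′ , _ =
    bob-wins a≤k (subst (_≤ _) (cong length (sym (++-identityʳ S))) (≤-trans |S|≤a a≤k)) wins′

  -- Cliques and edges.

  edge-clique : ∀ {u w} → Adj u w → (∀ {x} → Adj x u → ¬ Adj x w) → IsClique G (u ∷ w ∷ [])
  edge-clique {u} {w} uw no-common = complete , maximal
    where
    complete : Complete G (u ∷ w ∷ [])
    complete (here refl)         (here refl)         x≢y = contradiction refl x≢y
    complete (here refl)         (there (here refl)) _   = uw
    complete (there (here refl)) (here refl)         _   = adj-sym uw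
    complete (there (here refl)) (there (here refl)) x≢y = contradiction refl x≢y
    maximal : ∀ L → Complete G L → u ∷ w ∷ [] ⊆ L → L ⊆ u ∷ w ∷ []
    maximal L L-complete ⊆L {x} x∈L with x ≟ u | x ≟ w
    ... | yes refl | _        = here refl
    ... | no _     | yes refl = there (here refl)
    ... | no x≢u   | no x≢w   = contradiction
      (L-complete x∈L (⊆L (there (here refl))) x≢w)
      (no-common (L-complete x∈L (⊆L (here refl)) x≢u))

  -- Without isolated vertices a clique has two distinct vertices: the empty set is extended by
  -- `v₀`, and a single vertex by one of its neighbours. Since lists may repeat entries, a single
  -- vertex shows up as a list without an entry different from its head.
  clique-has-edge : V → (∀ v → ∃ (Adj v)) → ∀ K → IsClique G K →
                    ∃₂ λ u w → u ∈ K × w ∈ K × Adj u w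
  clique-has-edge v₀ nbr [] (_ , maximal) =
    contradiction (maximal (v₀ ∷ []) single (λ ()) (here refl)) ¬Any[]
    where
    single : Complete G (v₀ ∷ [])
    single (here refl) (here refl) v≢v = contradiction refl v≢v
  clique-has-edge _ nbr (v ∷ K) (complete , maximal) with Any.any? (λ w → ¬? (v ≟ w)) K
  ... | yes some with find some
  ... | w , w∈K , v≢w = v , w , here refl , there w∈K , complete (here refl) (there w∈K) v≢w
  clique-has-edge _ nbr (v ∷ K) (complete , maximal) | no none =
    contradiction (subst (Adj v) (only (maximal (v ∷ w ∷ []) pair ⊆pair (there (here refl)))) vw)
      adj-irrefl
    where
    w = proj₁ (nbr v)
    vw = proj₂ (nbr v)
    only : ∀ {x} → x ∈ v ∷ K → x ≡ v
    only (here refl) = refl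
    only {x} (there x∈K) with v ≟ x
    ... | yes refl = refl
    ... | no v≢x   = contradiction (lose x∈K v≢x) none
    ⊆pair : v ∷ K ⊆ v ∷ w ∷ []
    ⊆pair x∈ = here (only x∈)
    pair : Complete G (v ∷ w ∷ [])
    pair (here refl)         (here refl)         x≢y = contradiction refl x≢y
    pair (here refl)         (there (here refl)) _   = vw
    pair (there (here refl)) (here refl)         _   = adj-sym vw
    pair (there (here refl)) (there (here refl)) x≢y = contradiction refl x≢y

-- Degrees in cycles and paths

-- The candidates are natural numbers rather than elements of `Fin n`, so the bounding list may
-- contain values such as a successor that falls outside the range.
length-filter-≤ : ∀ {n} {P : Fin n → Set} (P? : Decidable P) {xs} →
                  (∀ {k} → P k → toℕ k ∈ xs) → length (filter P? (allFin n)) ≤ length xs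
length-filter-≤ {n} P? {xs} P⊆xs =
  subst (_≤ length xs) (length-map toℕ ks)
    (pigeonhole (Uniqueₚ.map⁺ toℕ-injective (Uniqueₚ.filter⁺ P? (allFin⁺ n))) sub)
  where
  ks = filter P? (allFin n)
  sub : map toℕ ks ⊆ xs
  sub y∈ with ∈-map⁻ toℕ y∈
  ... | k , k∈ , refl = P⊆xs (proj₂ (∈-filter⁻ P? {xs = allFin n} k∈))

length-filter-≥ : ∀ {n} {P : Fin n → Set} (P? : Decidable P) {ks} → Unique ks → All P ks →
                  length ks ≤ length (filter P? (allFin n))
length-filter-≥ P? ks! Pks =
  pigeonhole ks! (λ {k} k∈ → ∈-filter⁺ P? (∈-allFin k) (All.lookup Pks k∈))

ℕ-Adj : ℕ → ℕ → Set
ℕ-Adj a b = suc a ≡ b ⊎ suc b ≡ a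

ℕ-triangle-free : ∀ {a b c} → ℕ-Adj a b → ℕ-Adj c a → ¬ ℕ-Adj c b
ℕ-triangle-free (inj₁ refl) (inj₁ refl) (inj₁ ())
ℕ-triangle-free (inj₁ refl) (inj₁ refl) (inj₂ ())
ℕ-triangle-free (inj₁ refl) (inj₂ refl) (inj₁ ())
ℕ-triangle-free (inj₁ refl) (inj₂ refl) (inj₂ ())
ℕ-triangle-free (inj₂ refl) (inj₁ refl) (inj₁ ())
ℕ-triangle-free (inj₂ refl) (inj₁ refl) (inj₂ ())
ℕ-triangle-free (inj₂ refl) (inj₂ refl) (inj₁ ())
ℕ-triangle-free (inj₂ refl) (inj₂ refl) (inj₂ ())

module Path (m : ℕ) where
  open Graph (path m) public

  adj? : ∀ j → Decidable (Adj j)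
  adj? j k = (suc (toℕ j) ℕₚ.≟ toℕ k) ⊎-dec (suc (toℕ k) ℕₚ.≟ toℕ j)

  degree : Fin m → ℕ
  degree j = length (filter (adj? j) (allFin m))

  degree≤2 : ∀ j → degree j ≤ 2
  degree≤2 j = length-filter-≤ (adj? j) {suc (toℕ j) ∷ toℕ j ∸ 1 ∷ []} near
    where
    near : ∀ {k} → Adj j k → toℕ k ∈ suc (toℕ j) ∷ toℕ j ∸ 1 ∷ []
    near (inj₁ e) = here (sym e)
    near (inj₂ e) = there (here (cong (_∸ 1) e))

  2≤degree : ∀ j {k} → toℕ j ≡ suc k → suc (suc k) < m → 2 ≤ degree j
  2≤degree j {k} j≡ k+2<m =
    length-filter-≥ (adj? j) ((below≢above ∷ []) ∷ [] ∷ [])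
      (inj₂ (trans (cong suc (toℕ-fromℕ< k<m)) (sym j≡)) ∷
       inj₁ (trans (cong suc j≡) (sym (toℕ-fromℕ< k+2<m))) ∷ [])
    where
    k<m : k < m
    k<m = <-trans (n<1+n k) (<-trans (n<1+n (suc k)) k+2<m)
    below≢above : fromℕ< k<m ≢ fromℕ< k+2<m
    below≢above e with trans (sym (toℕ-fromℕ< k<m)) (trans (cong toℕ e) (toℕ-fromℕ< k+2<m))
    ... | ()

  neighbour : 2 ≤ m → ∀ j → ∃ (Adj j)
  neighbour 2≤m j = go (toℕ j) refl
    where
    go : ∀ a → toℕ j ≡ a → ∃ (Adj j)
    go zero    eq = fromℕ< 2≤m , inj₁ (trans (cong suc eq) (sym (toℕ-fromℕ< 2≤m)))
    go (suc k) eq = fromℕ< k<m , inj₂ (trans (cong suc (toℕ-fromℕ< k<m)) (sym eq))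
      where
      k<m : k < m
      k<m = <-trans (n<1+n k) (subst (_< m) eq (toℕ<n j))

  1≤degree : 2 ≤ m → ∀ j → 1 ≤ degree j
  1≤degree 2≤m j = length-filter-≥ (adj? j) ([] ∷ []) (proj₂ (neighbour 2≤m j) ∷ [])

module Cycle {n : ℕ} (3≤n : 3 ≤ n) where
  open Graph (cycle n 3≤n) public

  cyclicSuc? : ∀ (i k : Fin n) → Dec (CyclicSuc i k)
  cyclicSuc? i k = (suc (toℕ i) ℕₚ.≟ toℕ k) ⊎-dec (suc (toℕ i) ℕₚ.≟ n ×-dec toℕ k ℕₚ.≟ 0)

  adj? : ∀ i → Decidable (Adj i)
  adj? i k = cyclicSuc? i k ⊎-dec cyclicSuc? k i

  next : ∀ (i : Fin n) → ∃ (CyclicSuc i)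
  next i with m≤n⇒m<n∨m≡n (toℕ<n i)
  ... | inj₁ i+1<n = fromℕ< i+1<n , inj₁ (sym (toℕ-fromℕ< i+1<n))
  ... | inj₂ i+1≡n = fromℕ< 0<n , inj₂ (i+1≡n , toℕ-fromℕ< 0<n)
    where
    0<n : 0 < n
    0<n = ≤-trans (s≤s z≤n) 3≤n

  prev : ∀ (i : Fin n) → ∃ λ k → CyclicSuc k i
  prev i = go (toℕ i) refl
    where
    go : ∀ a → toℕ i ≡ a → ∃ λ k → CyclicSuc k i
    go zero eq = fromℕ< n-1<n , inj₂ (trans (cong suc (toℕ-fromℕ< n-1<n)) (m+[n∸m]≡n 1≤n) , eq)
      where
      1≤n : 1 ≤ n
      1≤n = ≤-trans (s≤s z≤n) 3≤n
      n-1<n : n ∸ 1 < n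
      n-1<n = ≤-reflexive (m+[n∸m]≡n 1≤n)
    go (suc k) eq = fromℕ< k<n , inj₁ (trans (cong suc (toℕ-fromℕ< k<n)) (sym eq))
      where
      k<n : k < n
      k<n = <-trans (n<1+n k) (subst (_< n) eq (toℕ<n i))

  suc-functional : ∀ {i k l : Fin n} → CyclicSuc i k → CyclicSuc i l → k ≡ l
  suc-functional (inj₁ e)       (inj₁ f)       = toℕ-injective (trans (sym e) f)
  suc-functional (inj₂ (_ , e)) (inj₂ (_ , f)) = toℕ-injective (trans e (sym f))
  suc-functional {k = k} (inj₁ e) (inj₂ (f , _)) = contradiction (trans (sym e) f) (<⇒≢ (toℕ<n k))
  suc-functional {l = l} (inj₂ (f , _)) (inj₁ e) = contradiction (trans (sym e) f) (<⇒≢ (toℕ<n l))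

  suc-injective′ : ∀ {i k l : Fin n} → CyclicSuc i l → CyclicSuc k l → i ≡ k
  suc-injective′ (inj₁ e)       (inj₁ f)       = toℕ-injective (suc-injective (trans e (sym f)))
  suc-injective′ (inj₂ (e , _)) (inj₂ (f , _)) = toℕ-injective (suc-injective (trans e (sym f)))
  suc-injective′ (inj₁ e)       (inj₂ (_ , f)) = contradiction (trans e f) 1+n≢0
  suc-injective′ (inj₂ (_ , f)) (inj₁ e)       = contradiction (trans e f) 1+n≢0

  no-2-cycle : ∀ {i k : Fin n} → CyclicSuc i k → ¬ CyclicSuc k i
  no-2-cycle s t = go 3≤n s t
    where
    -- The values of the vertices become variables, so that the equations can be matched with
    -- `refl`. Returning after two steps with one wrap-around forces `n = 2`.
    go : ∀ {n a b} → 3 ≤ n → suc a ≡ b ⊎ (suc a ≡ n × b ≡ 0) → ¬ (suc b ≡ a ⊎ (suc b ≡ n × a ≡ 0))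
    go _ (inj₁ refl) (inj₁ ())
    go (s≤s (s≤s ())) (inj₁ refl) (inj₂ (refl , refl))
    go (s≤s (s≤s ())) (inj₂ (refl , refl)) (inj₁ refl)

  no-3-cycle : 4 ≤ n → ∀ {i k l : Fin n} → CyclicSuc i k → CyclicSuc k l → ¬ CyclicSuc l i
  no-3-cycle 4≤n s t u = go 4≤n s t u
    where
    -- Likewise, three steps with one wrap-around force `n = 3`.
    go : ∀ {n a b c} → 4 ≤ n → suc a ≡ b ⊎ (suc a ≡ n × b ≡ 0) → suc b ≡ c ⊎ (suc b ≡ n × c ≡ 0) →
         ¬ (suc c ≡ a ⊎ (suc c ≡ n × a ≡ 0))
    go _ (inj₁ refl) (inj₁ refl) (inj₁ ())
    go (s≤s (s≤s (s≤s ()))) (inj₁ refl) (inj₁ refl) (inj₂ (refl , refl))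
    go (s≤s (s≤s (s≤s ()))) (inj₁ refl) (inj₂ (refl , refl)) (inj₁ refl)
    go (s≤s (s≤s (s≤s ()))) (inj₂ (refl , refl)) (inj₁ refl) (inj₁ refl)

  -- Orient each edge towards the cyclic successor. Either the triangle is a directed 3-cycle, or
  -- some vertex has two successors or two predecessors in it; these then coincide and leave a loop.
  triangle-free : 4 ≤ n → ∀ {i k l} → Adj i k → Adj l i → ¬ Adj l k
  triangle-free 4≤n (inj₁ ik) (inj₁ li) (inj₁ lk) with suc-functional li lk
  ... | refl = adj-irrefl (inj₁ ik)
  triangle-free 4≤n (inj₁ ik) (inj₁ li) (inj₂ kl) = no-3-cycle 4≤n ik kl li
  triangle-free 4≤n (inj₁ ik) (inj₂ il) lk with suc-functional ik il
  ... | refl = adj-irrefl lk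
  triangle-free 4≤n (inj₂ ki) (inj₁ li) lk with suc-injective′ ki li
  ... | refl = adj-irrefl lk
  triangle-free 4≤n (inj₂ ki) (inj₂ il) (inj₁ lk) = no-3-cycle 4≤n ki il lk
  triangle-free 4≤n (inj₂ ki) (inj₂ il) (inj₂ kl) with suc-functional ki kl
  ... | refl = adj-irrefl (inj₂ il)

  degree : Fin n → ℕ
  degree i = length (filter (adj? i) (allFin n))

  degree≤2 : ∀ i → degree i ≤ 2
  degree≤2 i = length-filter-≤ (adj? i) {toℕ (proj₁ (next i)) ∷ toℕ (proj₁ (prev i)) ∷ []} near
    where
    near : ∀ {k} → Adj i k → toℕ k ∈ toℕ (proj₁ (next i)) ∷ toℕ (proj₁ (prev i)) ∷ []
    near (inj₁ ik) = here (cong toℕ (suc-functional ik (proj₂ (next i))))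
    near (inj₂ ki) = there (here (cong toℕ (suc-injective′ ki (proj₂ (prev i)))))

  2≤degree : ∀ i → 2 ≤ degree i
  2≤degree i = length-filter-≥ (adj? i) ((next≢prev ∷ []) ∷ [] ∷ [])
    (inj₁ (proj₂ (next i)) ∷ inj₂ (proj₂ (prev i)) ∷ [])
    where
    next≢prev : proj₁ (next i) ≢ proj₁ (prev i)
    next≢prev e = no-2-cycle (proj₂ (next i)) (subst (λ k → CyclicSuc k i) (sym e) (proj₂ (prev i)))

-- Neighbour lists in Cartesian products.

module Box (A B : Graph)
  (adjᴬ? : ∀ i → Decidable (Graph.Adj A i)) (adjᴮ? : ∀ j → Decidable (Graph.Adj B j)) where
  private
    module A = Graph A
    module B = Graph B
  open Graph (A □ B)

  nbrs : Vertex → List Vertex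
  nbrs (i , j) = map (_, j) (filter (adjᴬ? i) A.vertices) ++ map (i ,_) (filter (adjᴮ? j) B.vertices)

  ∈-nbrs⁺ : ∀ {v w} → Adj v w → w ∈ nbrs v
  ∈-nbrs⁺ {i , j} (inj₁ (e , refl)) =
    ∈-++⁺ˡ (∈-map⁺ (_, j) (∈-filter⁺ (adjᴬ? i) (A.∈-vertices _) e))
  ∈-nbrs⁺ {i , j} (inj₂ (refl , e)) =
    ∈-++⁺ʳ (map (_, j) (filter (adjᴬ? i) A.vertices))
      (∈-map⁺ (i ,_) (∈-filter⁺ (adjᴮ? j) (B.∈-vertices _) e))

  ∈-nbrs⁻ : ∀ {v w} → w ∈ nbrs v → Adj v w
  ∈-nbrs⁻ {i , j} w∈ with ∈-++⁻ (map (_, j) (filter (adjᴬ? i) A.vertices)) w∈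
  ... | inj₁ w∈ˡ with ∈-map⁻ (_, j) w∈ˡ
  ... | k , k∈ , refl = inj₁ (proj₂ (∈-filter⁻ (adjᴬ? i) {xs = A.vertices} k∈) , refl)
  ∈-nbrs⁻ {i , j} w∈ | inj₂ w∈ʳ with ∈-map⁻ (i ,_) w∈ʳ
  ... | k , k∈ , refl = inj₂ (refl , proj₂ (∈-filter⁻ (adjᴮ? j) {xs = B.vertices} k∈))

  nbrs! : Unique A.vertices → Unique B.vertices → ∀ v → Unique (nbrs v)
  nbrs! A! B! (i , j) = Uniqueₚ.++⁺
    (Uniqueₚ.map⁺ (cong proj₁) (Uniqueₚ.filter⁺ (adjᴬ? i) A!))
    (Uniqueₚ.map⁺ (cong proj₂) (Uniqueₚ.filter⁺ (adjᴮ? j) B!))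
    disjoint
    where
    disjoint : Disjoint (map (_, j) (filter (adjᴬ? i) A.vertices))
                        (map (i ,_) (filter (adjᴮ? j) B.vertices))
    disjoint (w∈ˡ , w∈ʳ) with ∈-map⁻ (_, j) w∈ˡ | ∈-map⁻ (i ,_) w∈ʳ
    ... | k , k∈ , refl | l , l∈ , refl =
      A.adj-irrefl (proj₂ (∈-filter⁻ (adjᴬ? i) {xs = A.vertices} k∈))

  length-nbrs : ∀ i j → length (nbrs (i , j)) ≡
                length (filter (adjᴬ? i) A.vertices) + length (filter (adjᴮ? j) B.vertices)
  length-nbrs i j
    rewrite length-++ (map (_, j) (filter (adjᴬ? i) A.vertices)) {map (i ,_) (filter (adjᴮ? j) B.vertices)}
          | length-map (_, j) (filter (adjᴬ? i) A.vertices)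
          | length-map (i ,_) (filter (adjᴮ? j) B.vertices) = refl

-- Double counting over layers

-- weight j c bounds the number of vertices of layer j which lie in the closed
-- neighbourhood of a given vertex of layer c.
weight : ℕ → ℕ → ℕ
weight zero    zero          = 3
weight zero    (suc zero)    = 1
weight zero    (suc (suc _)) = 0
weight (suc j) (suc c)       = weight j c
weight (suc zero)    zero    = 1
weight (suc (suc _)) zero    = 0

weight-same : ∀ j → weight j j ≡ 3
weight-same zero    = refl
weight-same (suc j) = weight-same j

weight-adj : ∀ {j c} → ℕ-Adj j c → weight j c ≡ 1
weight-adj {zero}  (inj₁ refl) = refl
weight-adj {suc j} (inj₁ refl) = weight-adj {j} (inj₁ refl)
weight-adj {c = zero}  (inj₂ refl) = refl
weight-adj {c = suc c} (inj₂ refl) = weight-adj {suc c} {c} (inj₂ refl)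

Σ : List ℕ → (ℕ → ℕ) → ℕ
Σ cs f = sum (map f cs)

Σ-+ : ∀ cs f g → Σ cs (λ c → f c + g c) ≡ Σ cs f + Σ cs g
Σ-+ []       f g = refl
Σ-+ (c ∷ cs) f g =
  trans (cong (f c + g c +_) (Σ-+ cs f g)) (interchange (f c) (g c) (Σ cs f) (Σ cs g))

Σ-mono : ∀ cs {f g} → (∀ c → f c ≤ g c) → Σ cs f ≤ Σ cs g
Σ-mono []       f≤g = z≤n
Σ-mono (c ∷ cs) f≤g = +-mono-≤ (f≤g c) (Σ-mono cs f≤g)

Σ-const : ∀ cs k → Σ cs (λ _ → k) ≡ length cs * k
Σ-const []       k = refl
Σ-const (c ∷ cs) k = cong (k +_) (Σ-const cs k)

Σ-swap : ∀ js cs (f : ℕ → ℕ → ℕ) → Σ js (λ j → Σ cs (f j)) ≡ Σ cs (λ c → Σ js (λ j → f j c))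
Σ-swap []       cs f = sym (trans (Σ-const cs 0) (*-zeroʳ (length cs)))
Σ-swap (j ∷ js) cs f =
  trans (cong (Σ cs (f j) +_) (Σ-swap js cs f)) (sym (Σ-+ cs (f j) (λ c → Σ js (λ j → f j c))))

-- The counting consequence of layer `j` being dominated, where `cs` has one entry per red vertex,
-- namely its layer. Only this much of the red set is remembered.
Covers : ℕ → List ℕ → ℕ → Set
Covers n cs j = n ≤ Σ cs (weight j)

-- The weights are summed over `js` and `cs` in both orders: each covered layer receives at least
-- `n`, each red gives at most `k`. Repeating a layer in `js` gives it a larger coefficient.
double-count : ∀ {n k} js cs → All (Covers n cs) js → (∀ c → Σ js (λ j → weight j c) ≤ k) →
               length js * n ≤ length cs * k
double-count {n} {k} js cs js-covered bound = begin
  length js * n                        ≤⟨ lower js js-covered ⟩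
  Σ js (λ j → Σ cs (weight j))         ≡⟨ Σ-swap js cs weight ⟩
  Σ cs (λ c → Σ js (λ j → weight j c)) ≤⟨ Σ-mono cs bound ⟩
  Σ cs (λ _ → k)                       ≡⟨ Σ-const cs k ⟩
  length cs * k                        ∎
  where
  open ≤-Reasoning
  lower : ∀ js → All (Covers n cs) js → length js * n ≤ Σ js (λ j → Σ cs (weight j))
  lower []       []       = z≤n
  lower (j ∷ js) (p ∷ ps) = +-mono-≤ p (lower js ps)

double-count-≤ : ∀ {n k r} js cs → All (Covers n cs) js → (∀ c → Σ js (λ j → weight j c) ≤ k) →
                 length cs ≤ r → length js * n ≤ r * k
double-count-≤ js cs js-covered bound |cs|≤r =
  ≤-trans (double-count js cs js-covered bound) (*-monoˡ-≤ _ |cs|≤r)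

-- Three reds give one layer at most 9.
uncovered-1 : ∀ {n} cs → 10 ≤ n → length cs ≤ 3 → ¬ Covers n cs 1
uncovered-1 cs 10≤n |cs|≤3 c₁ = <⇒≱ 10≤n (≤-trans (m≤m+n _ 0)
  (double-count-≤ (1 ∷ []) cs (c₁ ∷ []) bound |cs|≤3))
  where
  bound : ∀ c → weight 1 c + 0 ≤ 3
  bound 0 = from-yes (1 ≤? 3)
  bound 1 = from-yes (3 ≤? 3)
  bound 2 = from-yes (1 ≤? 3)
  bound (suc (suc (suc _))) = z≤n

-- Since weight j c ≤ 1 + 2 [c = j], three reds cover a layer of at least 6
-- vertices only if two of them lie in it.
uncovered-12 : ∀ {n} cs → 6 ≤ n → length cs ≤ 3 → Covers n cs 1 → ¬ Covers n cs 2
uncovered-12 {n} cs 6≤n |cs|≤3 c₁ c₂ = <⇒≱ (≤-trans (+-mono-≤ (twice 1 c₁) (twice 2 c₂)) both) |cs|≤3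
  where
  open ≤-Reasoning
  δ : ℕ → ℕ → ℕ
  δ zero    zero    = 1
  δ zero    (suc _) = 0
  δ (suc _) zero    = 0
  δ (suc j) (suc c) = δ j c
  weight≤ : ∀ j c → weight j c ≤ 1 + (δ j c + δ j c)
  weight≤ zero    zero          = ≤-refl
  weight≤ zero    (suc zero)    = ≤-refl
  weight≤ zero    (suc (suc _)) = z≤n
  weight≤ (suc zero)    zero    = ≤-refl
  weight≤ (suc (suc _)) zero    = z≤n
  weight≤ (suc j) (suc c)       = weight≤ j c
  twice : ∀ j → Covers n cs j → 2 ≤ Σ cs (δ j)
  twice j cj = ≮⇒≥ λ Σ<2 → <⇒≱ 6≤n (begin
    n                                      ≤⟨ cj ⟩
    Σ cs (weight j)                        ≤⟨ Σ-mono cs (weight≤ j) ⟩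
    Σ cs (λ c → 1 + (δ j c + δ j c))       ≡⟨ Σ-+ cs (λ _ → 1) (λ c → δ j c + δ j c) ⟩
    Σ cs (λ _ → 1) + Σ cs (λ c → δ j c + δ j c)
      ≡⟨ cong₂ _+_ (Σ-const cs 1) (Σ-+ cs (δ j) (δ j)) ⟩
    length cs * 1 + (Σ cs (δ j) + Σ cs (δ j))
      ≤⟨ +-mono-≤ (*-monoˡ-≤ 1 |cs|≤3) (+-mono-≤ (≤-pred Σ<2) (≤-pred Σ<2)) ⟩
    5                                      ∎)
  both : Σ cs (δ 1) + Σ cs (δ 2) ≤ length cs
  both = begin
    Σ cs (δ 1) + Σ cs (δ 2)  ≡⟨ Σ-+ cs (δ 1) (δ 2) ⟨
    Σ cs (λ c → δ 1 c + δ 2 c) ≤⟨ Σ-mono cs bound ⟩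
    Σ cs (λ _ → 1)           ≡⟨ Σ-const cs 1 ⟩
    length cs * 1            ≡⟨ *-identityʳ (length cs) ⟩
    length cs                ∎
    where
    bound : ∀ c → δ 1 c + δ 2 c ≤ 1
    bound 0 = z≤n
    bound 1 = ≤-refl
    bound 2 = ≤-refl
    bound (suc (suc (suc _))) = z≤n

-- With layers 1 and 3 counted twice, no red covers more than 7.
uncovered-123 : ∀ cs → length cs ≤ 3 → Covers 5 cs 1 → Covers 5 cs 2 → ¬ Covers 5 cs 3
uncovered-123 cs |cs|≤3 c₁ c₂ c₃ = <⇒≱ (from-yes (21 <? 25))
  (double-count-≤ {k = 7} (1 ∷ 1 ∷ 2 ∷ 3 ∷ 3 ∷ []) cs (c₁ ∷ c₁ ∷ c₂ ∷ c₃ ∷ c₃ ∷ []) bound |cs|≤3)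
  where
  bound : ∀ c → Σ (1 ∷ 1 ∷ 2 ∷ 3 ∷ 3 ∷ []) (λ j → weight j c) ≤ 7
  bound 0 = from-yes (2 ≤? 7)
  bound 1 = ≤-refl
  bound 2 = ≤-refl
  bound 3 = ≤-refl
  bound 4 = from-yes (2 ≤? 7)
  bound (suc (suc (suc (suc (suc _))))) = z≤n

-- Over distinct layers a red contributes at most 3 + 1 + 1 = 5, once for its own layer and once for
-- each adjacent one; three reds give 15, and four layers need 16.
uncovered-1234 : ∀ cs → length cs ≤ 3 → Covers 4 cs 1 → Covers 4 cs 2 → Covers 4 cs 3 →
                 ¬ Covers 4 cs 4
uncovered-1234 cs |cs|≤3 c₁ c₂ c₃ c₄ = <⇒≱ (from-yes (15 <? 16))
  (double-count-≤ {k = 5} (1 ∷ 2 ∷ 3 ∷ 4 ∷ []) cs (c₁ ∷ c₂ ∷ c₃ ∷ c₄ ∷ []) bound |cs|≤3)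
  where
  bound : ∀ c → Σ (1 ∷ 2 ∷ 3 ∷ 4 ∷ []) (λ j → weight j c) ≤ 5
  bound 0 = from-yes (1 ≤? 5)
  bound 1 = from-yes (4 ≤? 5)
  bound 2 = ≤-refl
  bound 3 = ≤-refl
  bound 4 = from-yes (4 ≤? 5)
  bound 5 = from-yes (1 ≤? 5)
  bound (suc (suc (suc (suc (suc (suc _)))))) = z≤n

-- Of two adjacent layers a red can serve its own with 3 and the other with 1; two reds give 8, and
-- the layers need at least 10.
uncovered-01 : ∀ {n} cs → 5 ≤ n → length cs ≤ 2 → Covers n cs 0 → ¬ Covers n cs 1
uncovered-01 cs 5≤n |cs|≤2 c₀ c₁ = <⇒≱ (from-yes (8 <? 10)) (≤-trans (*-monoʳ-≤ 2 5≤n)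
  (double-count-≤ {k = 4} (0 ∷ 1 ∷ []) cs (c₀ ∷ c₁ ∷ []) bound |cs|≤2))
  where
  bound : ∀ c → Σ (0 ∷ 1 ∷ []) (λ j → weight j c) ≤ 4
  bound 0 = ≤-refl
  bound 1 = ≤-refl
  bound 2 = from-yes (1 ≤? 4)
  bound (suc (suc (suc _))) = z≤n

uncovered-012 : ∀ cs → length cs ≤ 2 → Covers 4 cs 0 → Covers 4 cs 1 → ¬ Covers 4 cs 2
uncovered-012 cs |cs|≤2 c₀ c₁ c₂ = <⇒≱ (from-yes (10 <? 12))
  (double-count-≤ {k = 5} (0 ∷ 1 ∷ 2 ∷ []) cs (c₀ ∷ c₁ ∷ c₂ ∷ []) bound |cs|≤2)
  where
  bound : ∀ c → Σ (0 ∷ 1 ∷ 2 ∷ []) (λ j → weight j c) ≤ 5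
  bound 0 = from-yes (4 ≤? 5)
  bound 1 = ≤-refl
  bound 2 = from-yes (4 ≤? 5)
  bound 3 = from-yes (1 ≤? 5)
  bound (suc (suc (suc (suc _)))) = z≤n

uncovered-0 : ∀ cs → length cs ≤ 1 → ¬ Covers 4 cs 0
uncovered-0 cs |cs|≤1 c₀ = <⇒≱ (from-yes (3 <? 4))
  (double-count-≤ {k = 3} (0 ∷ []) cs (c₀ ∷ []) bound |cs|≤1)
  where
  bound : ∀ c → Σ (0 ∷ []) (λ j → weight j c) ≤ 3
  bound 0 = ≤-refl
  bound 1 = from-yes (1 ≤? 3)
  bound (suc (suc _)) = z≤n

-- Bob's strategies

module Prism {n : ℕ} (3≤n : 3 ≤ n) (m : ℕ) where
  module C = Cycle 3≤n
  module P = Path m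

  G : Graph
  G = cycle n 3≤n □ path m

  open Graph G using (Vertex; Adj; adj-sym; adj-irrefl; _≟_)
  open Box (cycle n 3≤n) (path m) C.adj? P.adj? public

  layers : List Vertex → List ℕ
  layers = map (toℕ ∘ proj₂)

  layers≤ : ∀ R {k} → length R ≤ k → length (layers R) ≤ k
  layers≤ R = subst (_≤ _) (sym (length-map (toℕ ∘ proj₂) R))

  vertical-no-common : ∀ {i j k x} → P.Adj j k → Adj x (i , j) → ¬ Adj x (i , k)
  vertical-no-common jk (inj₁ (_ , refl))    (inj₁ (_ , refl)) = P.adj-irrefl jk
  vertical-no-common jk (inj₁ (e , refl))    (inj₂ (refl , _)) = C.adj-irrefl e
  vertical-no-common jk (inj₂ (refl , _))    (inj₁ (e , _))    = C.adj-irrefl e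
  vertical-no-common jk (inj₂ (_ , xj))      (inj₂ (_ , xk))   = ℕ-triangle-free jk xj xk

  horizontal-no-common : 4 ≤ n → ∀ {i k j x} → C.Adj i k → Adj x (i , j) → ¬ Adj x (k , j)
  horizontal-no-common 4≤n ik (inj₁ (xi , _))    (inj₁ (xk , _))   = C.triangle-free 4≤n ik xi xk
  horizontal-no-common 4≤n ik (inj₁ (_ , refl))  (inj₂ (_ , e))    = P.adj-irrefl e
  horizontal-no-common 4≤n ik (inj₂ (_ , e))     (inj₁ (_ , refl)) = P.adj-irrefl e
  horizontal-no-common 4≤n ik (inj₂ (refl , _))  (inj₂ (refl , _)) = C.adj-irrefl ik

  adj-clique : 4 ≤ n → ∀ {v w} → Adj v w → IsClique G (v ∷ w ∷ [])
  adj-clique 4≤n vw@(inj₁ (e , refl)) = edge-clique G vw (horizontal-no-common 4≤n e)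
  adj-clique 4≤n vw@(inj₂ (refl , e)) = edge-clique G vw (vertical-no-common e)

  -- The cycle coordinates of the vertices of layer `j` dominated by the given vertex: three in its
  -- own layer, one in an adjacent layer, none further away.
  shadow : Fin m → Vertex → List (Fin n)
  shadow j (i , k) with k Fin.≟ j | P.adj? j k
  ... | yes _ | _     = i ∷ filter (C.adj? i) (allFin n)
  ... | no _  | yes _ = i ∷ []
  ... | no _  | no _  = []

  length-shadow : ∀ j r → length (shadow j r) ≤ weight (toℕ j) (toℕ (proj₂ r))
  length-shadow j (i , k) with k Fin.≟ j | P.adj? j k
  ... | yes refl | _     = ≤-trans (s≤s (C.degree≤2 i)) (≤-reflexive (sym (weight-same (toℕ j))))
  ... | no _     | yes e = ≤-reflexive (sym (weight-adj e))
  ... | no _     | no _  = z≤n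

  length-shadows : ∀ j R → length (concatMap (shadow j) R) ≤ Σ (layers R) (weight (toℕ j))
  length-shadows j []      = z≤n
  length-shadows j (r ∷ R) = ≤-trans (≤-reflexive (length-++ (shadow j r)))
    (+-mono-≤ (length-shadow j r) (length-shadows j R))

  ∈-shadow : ∀ {i j r} → r ∈ (i , j) ∷ nbrs (i , j) → i ∈ shadow j r
  ∈-shadow {i} {j} (here refl) with j Fin.≟ j | P.adj? j j
  ... | yes _   | _ = here refl
  ... | no j≢j  | _ = contradiction refl j≢j
  ∈-shadow {i} {j} {r} (there r∈) = go r (∈-nbrs⁻ r∈)
    where
    go : ∀ r → Adj (i , j) r → i ∈ shadow j r
    go (k , l) (inj₁ (e , refl)) with l Fin.≟ l | P.adj? l l
    ... | yes _   | _ = there (∈-filter⁺ (C.adj? k) (∈-allFin i) (C.adj-sym e))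
    ... | no l≢l  | _ = contradiction refl l≢l
    go (k , l) (inj₂ (refl , e)) with l Fin.≟ j | P.adj? j l
    ... | yes refl | _     = contradiction e P.adj-irrefl
    ... | no _     | yes _ = here refl
    ... | no _     | no ¬e = contradiction e ¬e

  -- A vertex of layer j whose closed neighbourhood avoids the reds lets Bob threaten
  -- all its more than a neighbours at once.
  layer-covered : 4 ≤ n → ∀ {a R} j → a < 2 + P.degree j → AliceWins G a 1 bob ⟨ R , [] ⟩ →
                  Covers n (layers R) (toℕ j)
  layer-covered 4≤n {a} {R} j a<deg wins =
    subst (_≤ Σ (layers R) (weight (toℕ j))) (length-tabulate id)
      (≤-trans (pigeonhole (allFin⁺ n) (λ {i} _ → covered i)) (length-shadows j R))
    where
    open DecMembership _≟_ using (_∈?_)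
    covered : ∀ i → i ∈ concatMap (shadow j) R
    covered i with Any.any? (λ r → r ∈? ((i , j) ∷ nbrs (i , j))) R
    ... | yes hit = ∈-concatMap⁺ (shadow j) (Any.map ∈-shadow hit)
    ... | no miss = contradiction
      (threats≤a G (apart-bob G (λ { (_ , ()) }) v-free)
        (nbrs! (allFin⁺ n) (allFin⁺ m) v) (All.tabulate threat) (bob-plays G wins v-free))
      (<⇒≱ (≤-trans a<deg (≤-trans (+-monoˡ-≤ (P.degree j) (C.2≤degree i))
        (≤-reflexive (sym (length-nbrs i j))))))
      where
      v = (i , j)
      avoids : ∀ {w} → w ∈ v ∷ nbrs v → w ∉ R
      avoids w∈ w∈R = miss (lose w∈R w∈)
      v-free : Unplayed G ⟨ R , [] ⟩ v
      v-free = avoids (here refl) , ¬Any[]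
      threat : ∀ {w} → w ∈ nbrs v → Threat G ⟨ R , v ∷ [] ⟩ w
      threat {w} w∈ =
        (avoids (there w∈) , λ { (here refl) → adj-irrefl (∈-nbrs⁻ w∈) }) ,
        w ∷ v ∷ [] , adj-clique 4≤n (adj-sym (∈-nbrs⁻ w∈)) , λ x∈ → x∈


  -- Every layer has a neighbouring layer, so all degrees are at least 3 and exceed `a`. In
  -- `inner-covered` the layer has two neighbouring layers, and degree 4 exceeds `a ≤ 3`.
  outer-covered : 4 ≤ n → 2 ≤ m → ∀ {a R} k → k < m → a ≤ 2 → AliceWins G a 1 bob ⟨ R , [] ⟩ →
                  Covers n (layers R) k
  outer-covered 4≤n 2≤m {R = R} k k<m a≤2 wins = subst (Covers n (layers R)) (toℕ-fromℕ< k<m)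
    (layer-covered 4≤n (fromℕ< k<m)
      (s≤s (≤-trans a≤2 (s≤s (P.1≤degree 2≤m (fromℕ< k<m))))) wins)

  inner-covered : 4 ≤ n → ∀ {a R} k → suc (suc k) < m → a ≤ 3 → AliceWins G a 1 bob ⟨ R , [] ⟩ →
                  Covers n (layers R) (suc k)
  inner-covered 4≤n {R = R} k k+2<m a≤3 wins = subst (Covers n (layers R)) (toℕ-fromℕ< k+1<m)
    (layer-covered 4≤n (fromℕ< k+1<m)
      (s≤s (≤-trans a≤3 (s≤s (P.2≤degree (fromℕ< k+1<m) (toℕ-fromℕ< k+1<m) k+2<m)))) wins)
    where
    k+1<m = <-trans (n<1+n (suc k)) k+2<m

-- Bob's wins for cycles of length at least four.

module _ {n : ℕ} (3≤n : 3 ≤ n) (m : ℕ) where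
  open Prism 3≤n m

  bob-wins-n≥10 : ∀ {a R} → 10 ≤ n → 3 ≤ m → a ≤ 3 → length R ≤ 3 → ¬ AliceWins G a 1 bob ⟨ R , [] ⟩
  bob-wins-n≥10 {R = R} 10≤n 3≤m a≤3 |R|≤3 wins =
    uncovered-1 (layers R) 10≤n (layers≤ R |R|≤3)
      (inner-covered (≤-trans (from-yes (4 ≤? 10)) 10≤n) 0 3≤m a≤3 wins)

  bob-wins-n≥6 : ∀ {a R} → 6 ≤ n → 4 ≤ m → a ≤ 3 → length R ≤ 3 → ¬ AliceWins G a 1 bob ⟨ R , [] ⟩
  bob-wins-n≥6 {R = R} 6≤n 4≤m a≤3 |R|≤3 wins =
    uncovered-12 (layers R) 6≤n (layers≤ R |R|≤3) (covered 0 (<⇒≤ 4≤m)) (covered 1 4≤m)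
    where
    covered : ∀ k → suc (suc k) < m → Covers n (layers R) (suc k)
    covered k k+2<m = inner-covered (≤-trans (from-yes (4 ≤? 6)) 6≤n) k k+2<m a≤3 wins

  bob-wins-n≥5 : ∀ {a R} → 5 ≤ n → 2 ≤ m → a ≤ 2 → length R ≤ 2 → ¬ AliceWins G a 1 bob ⟨ R , [] ⟩
  bob-wins-n≥5 {R = R} 5≤n 2≤m a≤2 |R|≤2 wins =
    uncovered-01 (layers R) 5≤n (layers≤ R |R|≤2) (covered 0 (<⇒≤ 2≤m)) (covered 1 2≤m)
    where
    covered : ∀ k → k < m → Covers n (layers R) k
    covered k k<m = outer-covered (≤-trans (from-yes (4 ≤? 5)) 5≤n) 2≤m k k<m a≤2 wins

  bob-wins-first-m≥3 : ∀ {a} → 4 ≤ n → 3 ≤ m → a ≤ 3 → ¬ AliceWins G a 1 bob (start G)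
  bob-wins-first-m≥3 4≤n 3≤m a≤3 wins =
    -- Without reds, `Covers` reads `n ≤ 0`.
    <⇒≱ (≤-trans (s≤s z≤n) 4≤n) (inner-covered 4≤n 0 3≤m a≤3 wins)

  bob-wins-first-m≥2 : ∀ {a} → 4 ≤ n → 2 ≤ m → a ≤ 2 → ¬ AliceWins G a 1 bob (start G)
  bob-wins-first-m≥2 4≤n 2≤m a≤2 wins =
    <⇒≱ (≤-trans (s≤s z≤n) 4≤n) (outer-covered 4≤n 2≤m 0 (<⇒≤ 2≤m) a≤2 wins)

module _ (3≤5 : 3 ≤ 5) (m : ℕ) where
  open Prism 3≤5 m

  bob-wins-n≡5 : ∀ {a R} → 5 ≤ m → a ≤ 3 → length R ≤ 3 → ¬ AliceWins G a 1 bob ⟨ R , [] ⟩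
  bob-wins-n≡5 {R = R} 5≤m a≤3 |R|≤3 wins =
    uncovered-123 (layers R) (layers≤ R |R|≤3)
      (covered 0 (<⇒≤ (<⇒≤ 5≤m))) (covered 1 (<⇒≤ 5≤m)) (covered 2 5≤m)
    where
    covered : ∀ k → suc (suc k) < m → Covers 5 (layers R) (suc k)
    covered k k+2<m = inner-covered (from-yes (4 ≤? 5)) k k+2<m a≤3 wins

module _ (3≤4 : 3 ≤ 4) (m : ℕ) where
  open Prism 3≤4 m

  bob-wins-n≡4-m≥6 : ∀ {a R} → 6 ≤ m → a ≤ 3 → length R ≤ 3 → ¬ AliceWins G a 1 bob ⟨ R , [] ⟩
  bob-wins-n≡4-m≥6 {R = R} 6≤m a≤3 |R|≤3 wins =
    uncovered-1234 (layers R) (layers≤ R |R|≤3)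
      (covered 0 (<⇒≤ (<⇒≤ (<⇒≤ 6≤m)))) (covered 1 (<⇒≤ (<⇒≤ 6≤m))) (covered 2 (<⇒≤ 6≤m)) (covered 3 6≤m)
    where
    covered : ∀ k → suc (suc k) < m → Covers 4 (layers R) (suc k)
    covered k k+2<m = inner-covered ≤-refl k k+2<m a≤3 wins

  bob-wins-n≡4-m≥3 : ∀ {a R} → 3 ≤ m → a ≤ 2 → length R ≤ 2 → ¬ AliceWins G a 1 bob ⟨ R , [] ⟩
  bob-wins-n≡4-m≥3 {R = R} 3≤m a≤2 |R|≤2 wins =
    uncovered-012 (layers R) (layers≤ R |R|≤2) (covered 0 (<⇒≤ (<⇒≤ 3≤m))) (covered 1 (<⇒≤ 3≤m)) (covered 2 3≤m)
    where
    covered : ∀ k → k < m → Covers 4 (layers R) k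
    covered k k<m = outer-covered ≤-refl (<⇒≤ 3≤m) k k<m a≤2 wins

  bob-wins-n≡4-a≤1 : ∀ {a R} → 2 ≤ m → a ≤ 1 → length R ≤ 1 → ¬ AliceWins G a 1 bob ⟨ R , [] ⟩
  bob-wins-n≡4-a≤1 {R = R} 2≤m a≤1 |R|≤1 wins =
    uncovered-0 (layers R) (layers≤ R |R|≤1)
      (outer-covered ≤-refl 2≤m 0 (<⇒≤ 2≤m) (m≤n⇒m≤1+n a≤1) wins)

-- Triangular prisms: cliques and Bob's wins.

module Triangular (3≤3 : 3 ≤ 3) (m : ℕ) where
  open Prism 3≤3 m
  open Graph G using (Vertex; Adj; _≟_)

  triangle : Fin m → List Vertex
  triangle j = map (_, j) (allFin 3)

  ∈-triangle : ∀ {i j} → (i , j) ∈ triangle j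
  ∈-triangle {i} {j} = ∈-map⁺ (_, j) (∈-allFin i)

  C₃-complete : ∀ (i k : Fin 3) → i ≢ k → C.Adj i k
  C₃-complete i k i≢k
    with from-yes (Finₚ.all? (λ i → Finₚ.all? (λ k → (i Fin.≟ k) ⊎-dec C.adj? i k))) i k
  ... | inj₁ i≡k = contradiction i≡k i≢k
  ... | inj₂ e   = e

  layer-complete : ∀ j {u v} → proj₂ u ≡ j → proj₂ v ≡ j → u ≢ v → Adj u v
  layer-complete j {i , _} {k , _} refl refl u≢v =
    inj₁ (C₃-complete i k (λ i≡k → u≢v (cong (_, j) i≡k)) , refl)

  triangle-layer : ∀ j {v} → v ∈ triangle j → proj₂ v ≡ j
  triangle-layer j v∈ with ∈-map⁻ (_, j) v∈
  ... | _ , _ , refl = refl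

  triangle-complete : ∀ j → Complete G (triangle j)
  triangle-complete j u∈ v∈ = layer-complete j (triangle-layer j u∈) (triangle-layer j v∈)

  common-in-layer : ∀ {i k j x} → i ≢ k → Adj x (i , j) → Adj x (k , j) → proj₂ x ≡ j
  common-in-layer i≢k (inj₁ (_ , refl)) _                 = refl
  common-in-layer i≢k (inj₂ _)          (inj₁ (_ , refl)) = refl
  common-in-layer i≢k (inj₂ (refl , _)) (inj₂ (refl , _)) = contradiction refl i≢k

  -- Any further vertex is a common neighbour of two vertices of layer `j`. Outside the layer it
  -- would have to share its cycle coordinate with both, which are distinct.
  complete-in-layer : ∀ {L i k j} → Complete G L → (i , j) ∈ L → (k , j) ∈ L → i ≢ k →
                      ∀ {x} → x ∈ L → proj₂ x ≡ j
  complete-in-layer {i = i} {k} {j} L-complete i∈L k∈L i≢k {x} x∈L with x ≟ (i , j) | x ≟ (k , j)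
  ... | yes refl | _        = refl
  ... | no _     | yes refl = refl
  ... | no x≢i   | no x≢k   = common-in-layer i≢k (L-complete x∈L i∈L x≢i) (L-complete x∈L k∈L x≢k)

  triangle-clique : ∀ j → IsClique G (triangle j)
  triangle-clique j = triangle-complete j , maximal
    where
    maximal : ∀ L → Complete G L → triangle j ⊆ L → L ⊆ triangle j
    maximal L L-complete ⊆L {x} x∈L
      with complete-in-layer {i = zero} {suc zero} L-complete (⊆L ∈-triangle) (⊆L ∈-triangle) (λ ()) x∈L
    ... | refl = ∈-triangle

  vertical-clique : ∀ {i j k} → P.Adj j k → IsClique G ((i , k) ∷ (i , j) ∷ [])
  vertical-clique jk = edge-clique G (inj₂ (refl , P.adj-sym jk)) (vertical-no-common (P.adj-sym jk))

  column : Fin 3 → Fin m → List Vertex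
  column i j = map (i ,_) (filter (P.adj? j) (allFin m))

  column! : ∀ i j → Unique (column i j)
  column! i j = Uniqueₚ.map⁺ (cong proj₂) (Uniqueₚ.filter⁺ (P.adj? j) (allFin⁺ m))

  length-column : ∀ i j → length (column i j) ≡ P.degree j
  length-column i j = length-map (i ,_) (filter (P.adj? j) (allFin m))

  ∈-column⁻ : ∀ {i j w} → w ∈ column i j → ∃[ k ] (w ≡ (i , k) × P.Adj j k)
  ∈-column⁻ {i} {j} w∈ with ∈-map⁻ (i ,_) w∈
  ... | k , k∈ , w≡ = k , w≡ , proj₂ (∈-filter⁻ (P.adj? j) {xs = allFin m} k∈)

  -- The play at v forces Alice to spend her whole move on the path neighbours of
  -- v; the play at w then threatens its own path neighbours and x.
  bob-wins-layer : ∀ {a R} j v w x → v ≢ w → v ≢ x → w ≢ x →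
    (∀ i → i ≡ v ⊎ i ≡ w ⊎ i ≡ x) → a ≤ P.degree j →
    (∀ {r} → r ∈ R → proj₂ r ≢ j × (P.Adj j (proj₂ r) → proj₁ r ≡ x)) →
    ¬ AliceWins G a 1 bob ⟨ R , [] ⟩
  bob-wins-layer {a} {R} j v w x v≢w v≢x w≢x vwx a≤deg clear wins = <⇒≱
    (s≤s (≤-trans a≤deg (≤-reflexive (sym (length-column w j)))))
    (threats≤a G (apart-bob G apart₁ w-free) T! (All.tabulate threat₂) (bob-plays G wins₁ w-free))
    where
    in-layer-free : ∀ {i} → (i , j) ∉ R
    in-layer-free r∈ = proj₁ (clear r∈) refl
    column-free : ∀ {i k} → i ≢ x → P.Adj j k → (i , k) ∉ R
    column-free i≢x jk r∈ = i≢x (proj₂ (clear r∈) jk)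

    v-free : Unplayed G ⟨ R , [] ⟩ (v , j)
    v-free = in-layer-free , ¬Any[]
    apart₀ : Apart G ⟨ R , (v , j) ∷ [] ⟩
    apart₀ = apart-bob G (λ { (_ , ()) }) v-free
    threat₁ : ∀ {u} → u ∈ column v j → Threat G ⟨ R , (v , j) ∷ [] ⟩ u
    threat₁ u∈ with ∈-column⁻ u∈
    ... | k , refl , jk =
      (column-free v≢x jk , λ { (here refl) → P.adj-irrefl jk }) , _ , vertical-clique jk , λ y∈ → y∈

    answer = alice-answers G apart₀ (bob-plays G wins v-free)
    S = proj₁ answer
    |S|≤a = proj₁ (proj₂ answer)
    S-free = proj₁ (proj₂ (proj₂ answer))
    wins₁ = proj₁ (proj₂ (proj₂ (proj₂ answer)))
    answered = proj₂ (proj₂ (proj₂ (proj₂ answer)))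

    open DecMembership _≟_ using (_∈?_)
    -- The column of `v` has at least `a` vertices, all of them threatened; one more vertex in `S`
    -- would exceed `a`.
    S⊆column : S ⊆ column v j
    S⊆column {s} s∈S with s ∈? column v j
    ... | yes s∈ = s∈
    ... | no  s∉ = contradiction
      (≤-trans (≤-trans (pigeonhole (Allₚ.¬Any⇒All¬ _ s∉ ∷ column! v j) sub) |S|≤a)
        (≤-trans a≤deg (≤-reflexive (sym (length-column v j)))))
      1+n≰n
      where
      sub : s ∷ column v j ⊆ S
      sub (here refl) = s∈S
      sub (there u∈)  = answered (threat₁ u∈)

    apart₁ : Apart G ⟨ S ++ R , (v , j) ∷ [] ⟩
    apart₁ (u∈ , here refl) with ∈-++⁻ S u∈
    ... | inj₁ u∈S = proj₂ (All.lookup S-free u∈S) (here refl)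
    ... | inj₂ u∈R = in-layer-free u∈R

    untouched : ∀ {i k} → i ≢ v → (i , k) ∉ R → (i , k) ∉ S ++ R
    untouched i≢v ∉R ∈S++R with ∈-++⁻ S ∈S++R
    ... | inj₂ ∈R = ∉R ∈R
    ... | inj₁ ∈S with ∈-column⁻ (S⊆column ∈S)
    ... | _ , refl , _ = i≢v refl

    w-free : Unplayed G ⟨ S ++ R , (v , j) ∷ [] ⟩ (w , j)
    w-free = untouched (v≢w ∘ sym) in-layer-free , λ { (here refl) → v≢w refl }

    -- The last vertex of the triangle and the path neighbours of `w`: together one more than the
    -- path degree of `j`, hence more than `a`.
    T = (x , j) ∷ column w j
    T! : Unique T
    T! = All.tabulate x∉ ∷ column! w j
      where
      x∉ : ∀ {u} → u ∈ column w j → (x , j) ≢ u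
      x∉ u∈ refl with ∈-column⁻ u∈
      ... | _ , refl , jj = P.adj-irrefl jj

    threat₂ : ∀ {u} → u ∈ T → Threat G ⟨ S ++ R , (w , j) ∷ (v , j) ∷ [] ⟩ u
    threat₂ (here refl) =
      (untouched (v≢x ∘ sym) in-layer-free ,
        λ { (here refl) → w≢x refl ; (there (here refl)) → v≢x refl }) ,
      triangle j , triangle-clique j , sub
      where
      sub : triangle j ⊆ (x , j) ∷ (w , j) ∷ (v , j) ∷ []
      sub {i , _} y∈ with triangle-layer j y∈ | vwx i
      ... | refl | inj₁ refl        = there (there (here refl))
      ... | refl | inj₂ (inj₁ refl) = there (here refl)
      ... | refl | inj₂ (inj₂ refl) = here refl
    threat₂ (there u∈) with ∈-column⁻ u∈
    ... | k , refl , jk =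
      (untouched (v≢w ∘ sym) (column-free w≢x jk) ,
        λ { (here refl) → P.adj-irrefl jk ; (there (here refl)) → v≢w refl }) ,
      _ , vertical-clique jk , λ { (here refl) → here refl ; (there (here refl)) → there (here refl) }

  -- The column `x`, the only one in which adjacent layers may hold reds, is kept for the third
  -- vertex of the triangle; Bob plays in the other two.
  bob-wins-row : ∀ {a R} j x → a ≤ P.degree j →
    (∀ {r} → r ∈ R → proj₂ r ≢ j × (P.Adj j (proj₂ r) → proj₁ r ≡ x)) →
    ¬ AliceWins G a 1 bob ⟨ R , [] ⟩
  bob-wins-row j zero =
    bob-wins-layer j (suc zero) (suc (suc zero)) zero (λ ()) (λ ()) (λ ())
      λ { zero → inj₂ (inj₂ refl) ; (suc zero) → inj₁ refl ; (suc (suc zero)) → inj₂ (inj₁ refl) }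
  bob-wins-row j (suc zero) =
    bob-wins-layer j zero (suc (suc zero)) (suc zero) (λ ()) (λ ()) (λ ())
      λ { zero → inj₁ refl ; (suc zero) → inj₂ (inj₂ refl) ; (suc (suc zero)) → inj₂ (inj₁ refl) }
  bob-wins-row j (suc (suc zero)) =
    bob-wins-layer j zero (suc zero) (suc (suc zero)) (λ ()) (λ ()) (λ ())
      λ { zero → inj₁ refl ; (suc zero) → inj₂ (inj₁ refl) ; (suc (suc zero)) → inj₂ (inj₂ refl) }

  inner : ∀ {k} → suc (suc k) < m → ∃[ j ] (toℕ j ≡ suc k × 2 ≤ P.degree j)
  inner {k} k+2<m = fromℕ< k+1<m , toℕ-fromℕ< k+1<m ,
    P.2≤degree (fromℕ< k+1<m) (toℕ-fromℕ< k+1<m) k+2<m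
    where
    k+1<m = <-trans (n<1+n (suc k)) k+2<m

  bob-wins-n≡3-first : ∀ {a} → 3 ≤ m → a ≤ 2 → ¬ AliceWins G a 1 bob (start G)
  bob-wins-n≡3-first 3≤m a≤2 with inner 3≤m
  ... | j , _ , 2≤deg = bob-wins-row j zero (≤-trans a≤2 2≤deg) (λ ())

  -- A single red misses one of the layers 0 and 1. Bob attacks there, with the column of the red as
  -- the third one; path degree 1 is enough for `a ≤ 1`.
  bob-wins-n≡3-a≤1 : ∀ {a R} → 2 ≤ m → a ≤ 1 → length R ≤ 1 → ¬ AliceWins G a 1 bob ⟨ R , [] ⟩
  bob-wins-n≡3-a≤1 {a} {R} 2≤m a≤1 |R|≤1 = go R |R|≤1
    where
    bottom = fromℕ< (<⇒≤ 2≤m)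
    top = fromℕ< 2≤m
    a≤deg : ∀ j → a ≤ P.degree j
    a≤deg j = ≤-trans a≤1 (P.1≤degree 2≤m j)
    bottom≢top : bottom ≢ top
    bottom≢top e
      with trans (sym (toℕ-fromℕ< (<⇒≤ 2≤m))) (trans (cong toℕ e) (toℕ-fromℕ< 2≤m))
    ... | ()
    go : ∀ R → length R ≤ 1 → ¬ AliceWins G a 1 bob ⟨ R , [] ⟩
    go [] _ = bob-wins-row bottom zero (a≤deg bottom) (λ ())
    go ((i , k) ∷ []) _ with k Fin.≟ bottom
    ... | yes refl = bob-wins-row top i (a≤deg top) λ { (here refl) → bottom≢top , λ _ → refl }
    ... | no k≢    = bob-wins-row bottom i (a≤deg bottom) λ { (here refl) → k≢ , λ _ → refl }
    go (_ ∷ _ ∷ _) (s≤s ())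

  -- For reds in layers `c` and `d`, one of the layers 1 to 4 holds neither and is adjacent to at
  -- most one of the two layers, so at most one column near it is spoilt. Layer 4 serves if both
  -- reds are low, layer 1 if both are high.
  open-layer : ∀ c d → ∃[ k ] (k ≤ 3 × c ≢ suc k × d ≢ suc k × (¬ ℕ-Adj (suc k) c ⊎ ¬ ℕ-Adj (suc k) d))
  open-layer c d = by-cases c d (c ≤? 2) (d ≤? 2)
    where
    Open : ℕ → ℕ → Set
    Open c d = ∃[ k ] (k ≤ 3 × c ≢ suc k × d ≢ suc k × (¬ ℕ-Adj (suc k) c ⊎ ¬ ℕ-Adj (suc k) d))
    1-far : ∀ {c} → ¬ ℕ-Adj 1 (suc (suc (suc c)))
    1-far (inj₁ ())
    1-far (inj₂ ())
    4-far : ∀ {c} → c ≤ 2 → ¬ ℕ-Adj 4 c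
    4-far (s≤s (s≤s ())) (inj₁ refl)
    4-far (s≤s (s≤s ())) (inj₂ refl)
    ≢4 : ∀ {c} → c ≤ 2 → c ≢ 4
    ≢4 (s≤s (s≤s ())) refl
    -- The high red is in layer `3 + d`. Layer 1 serves unless `c` is 1; then layer 4 does, or layer
    -- 3 if the high red occupies layer 4.
    mixed : ∀ c d → c ≤ 2 → Open c (suc (suc (suc d)))
    mixed 0 d _ = 0 , z≤n , (λ ()) , (λ ()) , inj₂ 1-far
    mixed 1 0 _ = 3 , ≤-refl , (λ ()) , (λ ()) , inj₁ (4-far (s≤s z≤n))
    mixed 1 1 _ = 2 , from-yes (2 ≤? 3) , (λ ()) , (λ ()) , inj₁ λ { (inj₁ ()) ; (inj₂ ()) }
    mixed 1 (suc (suc d)) _ = 3 , ≤-refl , (λ ()) , (λ ()) , inj₁ (4-far (s≤s z≤n))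
    mixed 2 d _ = 0 , z≤n , (λ ()) , (λ ()) , inj₂ 1-far
    mixed (suc (suc (suc _))) _ (s≤s (s≤s ()))
    by-cases : ∀ c d → Dec (c ≤ 2) → Dec (d ≤ 2) → Open c d
    by-cases c d (yes c≤2) (yes d≤2) = 3 , ≤-refl , ≢4 c≤2 , ≢4 d≤2 , inj₁ (4-far c≤2)
    by-cases c d (yes c≤2) (no d≰2) with m≤n⇒∃[o]m+o≡n (≰⇒> d≰2)
    ... | d′ , refl = mixed c d′ c≤2
    by-cases c d (no c≰2) (yes d≤2) with m≤n⇒∃[o]m+o≡n (≰⇒> c≰2)
    ... | c′ , refl with mixed d c′ d≤2
    ... | k , k≤3 , d≢ , c≢ , far = k , k≤3 , c≢ , d≢ , swap far
    by-cases c d (no c≰2) (no d≰2) with m≤n⇒∃[o]m+o≡n (≰⇒> c≰2) | m≤n⇒∃[o]m+o≡n (≰⇒> d≰2)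
    ... | c′ , refl | d′ , refl = 0 , z≤n , (λ ()) , (λ ()) , inj₁ 1-far

  bob-wins-n≡3-m≥6 : ∀ {a R} → 6 ≤ m → a ≤ 2 → length R ≤ 2 → ¬ AliceWins G a 1 bob ⟨ R , [] ⟩
  bob-wins-n≡3-m≥6 {a} {R} 6≤m a≤2 |R|≤2 = go R |R|≤2
    where
    -- An inclusion, so that a single red is treated as the pair `r`, `r`.
    pair : ∀ {R} r s → R ⊆ r ∷ s ∷ [] → ¬ AliceWins G a 1 bob ⟨ R , [] ⟩
    pair {R} r s R⊆ with open-layer (toℕ (proj₂ r)) (toℕ (proj₂ s))
    ... | k , k≤3 , r≢ , s≢ , far with inner {k} (≤-trans (s≤s (s≤s (s≤s k≤3))) 6≤m)
    ... | j , j≡ , 2≤deg = by-far far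
      where
      a≤deg = ≤-trans a≤2 2≤deg
      misses : ∀ t → toℕ (proj₂ t) ≢ suc k → proj₂ t ≢ j
      misses t t≢ t≡j = t≢ (trans (cong toℕ t≡j) j≡)
      not-adj : ∀ t {A : Set} → ¬ ℕ-Adj (suc k) (toℕ (proj₂ t)) → P.Adj j (proj₂ t) → A
      not-adj t ¬adj e = ⊥-elim (¬adj (subst (λ l → ℕ-Adj l (toℕ (proj₂ t))) j≡ e))
      by-far : ¬ ℕ-Adj (suc k) (toℕ (proj₂ r)) ⊎ ¬ ℕ-Adj (suc k) (toℕ (proj₂ s)) →
               ¬ AliceWins G a 1 bob ⟨ R , [] ⟩
      by-far (inj₁ r-far) = bob-wins-row j (proj₁ s) a≤deg (clear ∘ R⊆)
        where
        clear : ∀ {t} → t ∈ r ∷ s ∷ [] → proj₂ t ≢ j × (P.Adj j (proj₂ t) → proj₁ t ≡ proj₁ s)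
        clear (here refl)         = misses r r≢ , not-adj r r-far
        clear (there (here refl)) = misses s s≢ , λ _ → refl
      by-far (inj₂ s-far) = bob-wins-row j (proj₁ r) a≤deg (clear ∘ R⊆)
        where
        clear : ∀ {t} → t ∈ r ∷ s ∷ [] → proj₂ t ≢ j × (P.Adj j (proj₂ t) → proj₁ t ≡ proj₁ r)
        clear (here refl)         = misses r r≢ , λ _ → refl
        clear (there (here refl)) = misses s s≢ , not-adj s s-far
    go : ∀ R → length R ≤ 2 → ¬ AliceWins G a 1 bob ⟨ R , [] ⟩
    go [] _ = bob-wins-n≡3-first (<⇒≤ (<⇒≤ (<⇒≤ 6≤m))) a≤2
    go (r ∷ []) _ = pair r r λ { (here refl) → here refl }
    go (r ∷ s ∷ []) _ = pair r s id
    go (_ ∷ _ ∷ _ ∷ _) (s≤s (s≤s ()))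

-- Alice's strategies

module AdjacencyReplies {n : ℕ} (3≤n : 3 ≤ n) {m : ℕ} (2≤m : 2 ≤ m) where
  open Prism 3≤n m
  open Graph G

  open Replies G Adj adj-sym adj-irrefl
    (clique-has-edge G (fromℕ< (≤-trans (s≤s z≤n) 3≤n) , fromℕ< (<⇒≤ 2≤m))
      (λ (i , j) → (proj₁ (C.next i) , j) , inj₁ (inj₁ (proj₂ (C.next i)) , refl)))
    nbrs ∈-nbrs⁺ public

  length-nbrs≤ : ∀ {d} → (∀ j → P.degree j ≤ d) → ∀ v → length (nbrs v) ≤ 2 + d
  length-nbrs≤ deg≤ (i , j) =
    ≤-trans (≤-reflexive (length-nbrs i j)) (+-mono-≤ (C.degree≤2 i) (deg≤ j))

P₂-degree≤1 : ∀ j → Path.degree 2 j ≤ 1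
P₂-degree≤1 = from-yes (Finₚ.all? (λ j → Path.degree 2 j ≤? 1))

-- The edge {0, 1} of a triangle, together with the path edges, meets every clique of
-- C₃ □ Pₘ and has smaller degrees than C₃ □ Pₘ itself.
mates : Graph
mates = record
  { Vertex     = Fin 3
  ; Adj        = λ i k → toℕ i + toℕ k ≡ 1
  ; adj-sym    = λ {i} {k} e → trans (+-comm (toℕ k) (toℕ i)) e
  ; adj-irrefl = λ { {zero} () ; {suc zero} () ; {suc (suc zero)} () }
  ; _≟_        = Fin._≟_
  ; vertices   = allFin 3
  ; ∈-vertices = ∈-allFin
  }

module MateReplies (3≤3 : 3 ≤ 3) {m : ℕ} (2≤m : 2 ≤ m) where
  open Prism 3≤3 m using (G; module C; module P)
  open Triangular 3≤3 m
  open Graph G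
  private module H = Graph (mates □ path m)

  mate? : ∀ i → Decidable (Graph.Adj mates i)
  mate? i k = toℕ i + toℕ k ℕₚ.≟ 1

  open Box mates (path m) mate? P.adj?

  -- An edge of the clique along the path is itself an `H`-edge. An edge inside a layer confines the
  -- clique to that triangle, which it fills by maximality, so it contains the edge between 0 and 1.
  H-in-clique : ∀ K → IsClique G K → ∃₂ λ u w → u ∈ K × w ∈ K × H.Adj u w
  H-in-clique K K-clique
    with clique-has-edge G (zero , fromℕ< (<⇒≤ 2≤m))
           (λ (i , j) → (i , proj₁ (P.neighbour 2≤m j)) , inj₂ (refl , proj₂ (P.neighbour 2≤m j)))
           K K-clique
  ... | u , w , u∈K , w∈K , inj₂ e = u , w , u∈K , w∈K , inj₂ e
  ... | (i , j) , (k , _) , u∈K , w∈K , inj₁ (e , refl) =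
    (zero , j) , (suc zero , j) , triangle⊆K ∈-triangle , triangle⊆K ∈-triangle , inj₁ (refl , refl)
    where
    K⊆triangle : K ⊆ triangle j
    K⊆triangle {x} x∈K
      with complete-in-layer (proj₁ K-clique) u∈K w∈K (λ { refl → C.adj-irrefl e }) x∈K
    ... | refl = ∈-triangle
    triangle⊆K : triangle j ⊆ K
    triangle⊆K = proj₂ K-clique (triangle j) (triangle-complete j) K⊆triangle

  open Replies G H.Adj (λ {u} {v} → H.adj-sym {u} {v}) (λ {v} → H.adj-irrefl {v})
    H-in-clique nbrs ∈-nbrs⁺ public

  length-nbrs≤ : ∀ {d} → (∀ j → P.degree j ≤ d) → ∀ v → length (nbrs v) ≤ 1 + d
  length-nbrs≤ deg≤ (i , j) = ≤-trans (≤-reflexive (length-nbrs i j)) (+-mono-≤ (mates≤1 i) (deg≤ j))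
    where
    mates≤1 : ∀ i → length (filter (mate? i) (allFin 3)) ≤ 1
    mates≤1 = from-yes (Finₚ.all? (λ i → length (filter (mate? i) (allFin 3)) ≤? 1))

-- Only columns 0 and 1 of the inner layers have `H`-degree 3. The opening dominates these vertices
-- within `H`, which two reds achieve for up to three inner layers.
alice-wins-n≡3 : ∀ 3≤3 {m} (2≤m : 2 ≤ m) → m ≤ 5 → AliceWins (cycle 3 3≤3 □ path m) 2 1 alice (start _)
alice-wins-n≡3 3≤3 {1} (s≤s ()) _
alice-wins-n≡3 3≤3 {2} 2≤m _ = MateReplies.check⇒alice 3≤3 2≤m 2 []
alice-wins-n≡3 3≤3 {3} 2≤m _ = MateReplies.check⇒alice 3≤3 2≤m 2 ((# 0 , # 1) ∷ [])
alice-wins-n≡3 3≤3 {4} 2≤m _ = MateReplies.check⇒alice 3≤3 2≤m 2 ((# 0 , # 1) ∷ (# 0 , # 2) ∷ [])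
alice-wins-n≡3 3≤3 {5} 2≤m _ = MateReplies.check⇒alice 3≤3 2≤m 2 ((# 0 , # 1) ∷ (# 1 , # 3) ∷ [])
alice-wins-n≡3 3≤3 {suc (suc (suc (suc (suc (suc _)))))} _ (s≤s (s≤s (s≤s (s≤s (s≤s ())))))

-- The graph is the cube, and the two reds are antipodal: every other vertex has exactly one of them
-- among its three neighbours.
alice-wins-n≡4-a≡2 : ∀ 3≤4 → AliceWins (cycle 4 3≤4 □ path 2) 2 1 alice (start _)
alice-wins-n≡4-a≡2 3≤4 = AdjacencyReplies.check⇒alice 3≤4 ≤-refl 2 ((# 0 , # 0) ∷ (# 2 , # 1) ∷ [])

-- The vertices of degree 4 are those of the inner layers, and each opening dominates all of these.
alice-wins-n≡4 : ∀ 3≤4 {m} (2≤m : 2 ≤ m) → 3 ≤ m → m ≤ 5 → AliceWins (cycle 4 3≤4 □ path m) 3 1 alice (start _)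
alice-wins-n≡4 3≤4 {2} 2≤m (s≤s (s≤s ())) _
alice-wins-n≡4 3≤4 {3} 2≤m _ _ = AdjacencyReplies.check⇒alice 3≤4 2≤m 3 ((# 0 , # 1) ∷ (# 2 , # 1) ∷ [])
alice-wins-n≡4 3≤4 {4} 2≤m _ _ = AdjacencyReplies.check⇒alice 3≤4 2≤m 3 ((# 0 , # 1) ∷ (# 2 , # 2) ∷ [])
alice-wins-n≡4 3≤4 {5} 2≤m _ _ =
  AdjacencyReplies.check⇒alice 3≤4 2≤m 3 ((# 0 , # 2) ∷ (# 2 , # 1) ∷ (# 2 , # 3) ∷ [])
alice-wins-n≡4 3≤4 {suc (suc (suc (suc (suc (suc _)))))} _ _ (s≤s (s≤s (s≤s (s≤s (s≤s ())))))

alice-wins-n≡5 : ∀ 3≤5 {m} (2≤m : 2 ≤ m) → m ≤ 4 → AliceWins (cycle 5 3≤5 □ path m) 3 1 alice (start _)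
alice-wins-n≡5 3≤5 {1} (s≤s ()) _
alice-wins-n≡5 3≤5 {2} 2≤m _ = AdjacencyReplies.check⇒alice 3≤5 2≤m 3 []
alice-wins-n≡5 3≤5 {3} 2≤m _ = AdjacencyReplies.check⇒alice 3≤5 2≤m 3 ((# 0 , # 1) ∷ (# 2 , # 1) ∷ [])
alice-wins-n≡5 3≤5 {4} 2≤m _ =
  AdjacencyReplies.check⇒alice 3≤5 2≤m 3 ((# 0 , # 1) ∷ (# 2 , # 2) ∷ (# 3 , # 2) ∷ [])
alice-wins-n≡5 3≤5 {suc (suc (suc (suc (suc _))))} _ (s≤s (s≤s (s≤s (s≤s ()))))

-- Only the middle layer has degree 4. Reds at most three steps apart dominate it, and three of them
-- suffice up to `n = 9`.
alice-wins-m≡3 : ∀ d 3≤n (2≤3 : 2 ≤ 3) → d ≤ 3 → AliceWins (cycle (6 + d) 3≤n □ path 3) 3 1 alice (start _)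
alice-wins-m≡3 0 3≤n 2≤3 _ = AdjacencyReplies.check⇒alice 3≤n 2≤3 3 ((# 0 , # 1) ∷ (# 3 , # 1) ∷ [])
alice-wins-m≡3 1 3≤n 2≤3 _ =
  AdjacencyReplies.check⇒alice 3≤n 2≤3 3 ((# 0 , # 1) ∷ (# 3 , # 1) ∷ (# 5 , # 1) ∷ [])
alice-wins-m≡3 2 3≤n 2≤3 _ =
  AdjacencyReplies.check⇒alice 3≤n 2≤3 3 ((# 0 , # 1) ∷ (# 3 , # 1) ∷ (# 6 , # 1) ∷ [])
alice-wins-m≡3 3 3≤n 2≤3 _ =
  AdjacencyReplies.check⇒alice 3≤n 2≤3 3 ((# 0 , # 1) ∷ (# 3 , # 1) ∷ (# 6 , # 1) ∷ [])
alice-wins-m≡3 (suc (suc (suc (suc _)))) _ _ (s≤s (s≤s (s≤s ())))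

-- The threshold values.

smallest : ∀ {P : ℕ → Set} {k} → P (suc k) → (∀ {j} → j ≤ k → ¬ P j) → IsSmallestPositive P (suc k)
smallest p least = s≤s z≤n , p , λ j _ pj → ≰⇒> λ j≤k → least j≤k pj

module Values (n m : ℕ) (3≤n : 3 ≤ n) (2≤m : 2 ≤ m) where

  Two Three : Set
  Two   = (n ≡ 3 × 2 ≤ m × m ≤ 5) ⊎ (n ≡ 4 × m ≡ 2)
  Three = (n ≡ 3 × 6 ≤ m)
        ⊎ (n ≡ 4 × 3 ≤ m × m ≤ 5)
        ⊎ (n ≡ 5 × 2 ≤ m × m ≤ 4)
        ⊎ (6 ≤ n × n ≤ 9 × (m ≡ 2 ⊎ m ≡ 3))
        ⊎ (10 ≤ n × m ≡ 2)

  G : Graph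
  G = cycle n 3≤n □ path m

  a₁≡2 : Two → G HasA₁ 2
  a₁≡2 (inj₁ (refl , _ , m≤5)) = smallest (alice-wins-n≡3 3≤n 2≤m m≤5)
    (λ a≤1 → alice-loses G a≤1 (Triangular.bob-wins-n≡3-a≤1 3≤n m 2≤m))
  a₁≡2 (inj₂ (refl , refl)) = smallest (alice-wins-n≡4-a≡2 3≤n)
    (λ a≤1 → alice-loses G a≤1 (bob-wins-n≡4-a≤1 3≤n m 2≤m))

  module _ where
    open AdjacencyReplies 3≤n 2≤m

    alice-wins-a≡4 : AliceWins G 4 1 alice (start G) × AliceWins G 4 1 bob (start G)
    alice-wins-a≡4 = short⇒alice deg≤4 , short⇒bob deg≤4
      where deg≤4 = length-nbrs≤ (Path.degree≤2 m)

    alice-wins-m≡2 : m ≡ 2 → AliceWins G 3 1 alice (start G) × AliceWins G 3 1 bob (start G)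
    alice-wins-m≡2 refl = short⇒alice deg≤3 , short⇒bob deg≤3
      where deg≤3 = length-nbrs≤ P₂-degree≤1

  alice-wins-n≡3-a≡3 : n ≡ 3 → AliceWins G 3 1 alice (start G) × AliceWins G 3 1 bob (start G)
  alice-wins-n≡3-a≡3 refl = short⇒alice deg≤3 , short⇒bob deg≤3
    where
    open MateReplies 3≤n 2≤m
    deg≤3 = length-nbrs≤ (Path.degree≤2 m)

  a₁≡3 : Three → G HasA₁ 3
  a₁≡3 (inj₁ (refl , 6≤m)) = smallest (proj₁ (alice-wins-n≡3-a≡3 refl))
    (λ a≤2 → alice-loses G a≤2 (Triangular.bob-wins-n≡3-m≥6 3≤n m 6≤m))
  a₁≡3 (inj₂ (inj₁ (refl , 3≤m , m≤5))) = smallest (alice-wins-n≡4 3≤n 2≤m 3≤m m≤5)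
    (λ a≤2 → alice-loses G a≤2 (bob-wins-n≡4-m≥3 3≤n m 3≤m))
  a₁≡3 (inj₂ (inj₂ (inj₁ (refl , _ , m≤4)))) = smallest (alice-wins-n≡5 3≤n 2≤m m≤4)
    (λ a≤2 → alice-loses G a≤2 (bob-wins-n≥5 3≤n m ≤-refl 2≤m))
  a₁≡3 (inj₂ (inj₂ (inj₂ (inj₁ (6≤n , n≤9 , m≡2∨3))))) = smallest (wins m≡2∨3)
    (λ a≤2 → alice-loses G a≤2 (bob-wins-n≥5 3≤n m (<⇒≤ 6≤n) 2≤m))
    where
    wins : m ≡ 2 ⊎ m ≡ 3 → AliceWins G 3 1 alice (start G)
    wins (inj₁ m≡2) = proj₁ (alice-wins-m≡2 m≡2)
    wins (inj₂ refl) with m≤n⇒∃[o]m+o≡n 6≤n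
    ... | d , refl = alice-wins-m≡3 d 3≤n 2≤m (+-cancelˡ-≤ 6 d 3 n≤9)
  a₁≡3 (inj₂ (inj₂ (inj₂ (inj₂ (10≤n , m≡2))))) = smallest (proj₁ (alice-wins-m≡2 m≡2))
    (λ a≤2 → alice-loses G a≤2 (bob-wins-n≥5 3≤n m (≤-trans (from-yes (5 ≤? 10)) 10≤n) 2≤m))

  -- The cases left by `Two` and `Three`, sorted by the counting argument with which Bob beats
  -- `a ≤ 3`; the last two overlap.
  data Large : Set where
    n≡4  : n ≡ 4 → 6 ≤ m → Large
    n≡5  : n ≡ 5 → 5 ≤ m → Large
    n≥6  : 6 ≤ n → 4 ≤ m → Large
    n≥10 : 10 ≤ n → 3 ≤ m → Large

  large : ¬ Two → ¬ Three → Large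
  large ¬two ¬three with m≤n⇒m<n∨m≡n 3≤n
  ... | inj₂ refl with m ≤? 5
  ... | yes m≤5 = contradiction (inj₁ (refl , 2≤m , m≤5)) ¬two
  ... | no  m≰5 = contradiction (inj₁ (refl , ≰⇒> m≰5)) ¬three
  large ¬two ¬three | inj₁ 4≤n with m≤n⇒m<n∨m≡n 4≤n
  large ¬two ¬three | inj₁ _ | inj₂ refl with m≤n⇒m<n∨m≡n 2≤m | m ≤? 5
  ... | inj₂ refl | _       = contradiction (inj₂ (refl , refl)) ¬two
  ... | inj₁ 3≤m  | yes m≤5 = contradiction (inj₂ (inj₁ (refl , 3≤m , m≤5))) ¬three
  ... | inj₁ _    | no m≰5  = n≡4 refl (≰⇒> m≰5)
  large ¬two ¬three | inj₁ _ | inj₁ 5≤n with m≤n⇒m<n∨m≡n 5≤n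
  large ¬two ¬three | inj₁ _ | inj₁ _ | inj₂ refl with m ≤? 4
  ... | yes m≤4 = contradiction (inj₂ (inj₂ (inj₁ (refl , 2≤m , m≤4)))) ¬three
  ... | no  m≰4 = n≡5 refl (≰⇒> m≰4)
  large ¬two ¬three | inj₁ _ | inj₁ _ | inj₁ 6≤n with 4 ≤? m | n ≤? 9
  ... | yes 4≤m | _      = n≥6 6≤n 4≤m
  ... | no  4≰m | n≤9? with m≤n⇒m<n∨m≡n 2≤m | n≤9?
  ... | inj₂ refl | yes n≤9 = contradiction (inj₂ (inj₂ (inj₂ (inj₁ (6≤n , n≤9 , inj₁ refl))))) ¬three
  ... | inj₂ refl | no  n≰9 = contradiction (inj₂ (inj₂ (inj₂ (inj₂ (≰⇒> n≰9 , refl))))) ¬three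
  ... | inj₁ 3≤m  | no  n≰9 = n≥10 (≰⇒> n≰9) 3≤m
  ... | inj₁ 3≤m  | yes n≤9 =
    contradiction (inj₂ (inj₂ (inj₂ (inj₁ (6≤n , n≤9 , inj₂ (≤-antisym (≮⇒≥ 4≰m) 3≤m)))))) ¬three

  a₁≡4 : ¬ Two → ¬ Three → G HasA₁ 4
  a₁≡4 ¬two ¬three = smallest (proj₁ alice-wins-a≡4) (λ a≤3 → alice-loses G a≤3 (bob-wins (large ¬two ¬three)))
    where
    bob-wins : Large → ∀ {a R} → a ≤ 3 → length R ≤ 3 → ¬ AliceWins G a 1 bob ⟨ R , [] ⟩
    bob-wins (n≡4 refl 6≤m)  = bob-wins-n≡4-m≥6 3≤n m 6≤m
    bob-wins (n≡5 refl 5≤m)  = bob-wins-n≡5 3≤n m 5≤m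
    bob-wins (n≥6 6≤n 4≤m)   = bob-wins-n≥6 3≤n m 6≤n 4≤m
    bob-wins (n≥10 10≤n 3≤m) = bob-wins-n≥10 3≤n m 10≤n 3≤m

  a₁′≡2 : n ≡ 3 × m ≡ 2 → G HasA₁′ 2
  a₁′≡2 (refl , refl) = smallest (short⇒bob (length-nbrs≤ P₂-degree≤1))
    (λ a≤1 → Triangular.bob-wins-n≡3-a≤1 3≤n m 2≤m a≤1 z≤n)
    where open MateReplies 3≤n 2≤m

  a₁′≡3 : (n ≡ 3 × 3 ≤ m) ⊎ (4 ≤ n × m ≡ 2) → G HasA₁′ 3
  a₁′≡3 (inj₁ (refl , 3≤m)) = smallest (proj₂ (alice-wins-n≡3-a≡3 refl))
    (Triangular.bob-wins-n≡3-first 3≤n m 3≤m)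
  a₁′≡3 (inj₂ (4≤n , m≡2)) = smallest (proj₂ (alice-wins-m≡2 m≡2)) (bob-wins-first-m≥2 3≤n m 4≤n 2≤m)

  a₁′≡4 : 4 ≤ n × 3 ≤ m → G HasA₁′ 4
  a₁′≡4 (4≤n , 3≤m) = smallest (proj₂ alice-wins-a≡4) (bob-wins-first-m≥3 3≤n m 4≤n 3≤m)

theorem4p2 : (n m : ℕ) (3≤n : 3 ≤ n) → 2 ≤ m →
  let G = cycle n 3≤n □ path m
      Two   = (n ≡ 3 × 2 ≤ m × m ≤ 5) ⊎ (n ≡ 4 × m ≡ 2)
      Three = (n ≡ 3 × 6 ≤ m)
            ⊎ (n ≡ 4 × 3 ≤ m × m ≤ 5)
            ⊎ (n ≡ 5 × 2 ≤ m × m ≤ 4)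
            ⊎ (6 ≤ n × n ≤ 9 × (m ≡ 2 ⊎ m ≡ 3))
            ⊎ (10 ≤ n × m ≡ 2)
  in
  ((Two → G HasA₁ 2) ×
   (Three → G HasA₁ 3) ×
   (¬ Two → ¬ Three → G HasA₁ 4)) ×
  (((n ≡ 3 × m ≡ 2) → G HasA₁′ 2) ×
   ((n ≡ 3 × 3 ≤ m) ⊎ (4 ≤ n × m ≡ 2) → G HasA₁′ 3) ×
   (4 ≤ n × 3 ≤ m → G HasA₁′ 4))
theorem4p2 n m 3≤n 2≤m = (a₁≡2 , a₁≡3 , a₁≡4) , (a₁′≡2 , a₁′≡3 , a₁′≡4)
  where open Values n m 3≤n 2≤m
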